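{- For every ordinal notation $a\in\mathcal{O}$ there is a $2$-bounded computable function $f:B_2*B_a\to\mathbb{N}$ with no infinite rainbow computable in $H_a$; that is, there is no infinite set $X\subseteq\mathbb{N}$ computable in $H_a$ such that $f$ is injective on $\{s\in B_2*B_a: s\subseteq X\}$.
   Context: $\mathbb{N}$ is the set of natural numbers (including $0$); $\varphi_z$ is the $z$-th partial computable function. A function $f$ is $2$-bounded if every value has at most $2$ preimages under $f$. Kleene's $\mathcal{O}$ with its order $<_{\mathcal{O}}$ is the usual system of notations for computable ordinals: $1\in\mathcal{O}$ denotes $0$; if $a\in\mathcal{O}$ denotes $\alpha$ then $2^a\in\mathcal{O}$ denotes $\alpha+1$, with $a<_{\mathcal{O}}2^a$; if $\varphi_z$ is total, $\varphi_z(n)\in\mathcal{O}$ and $\varphi_z(n)<_{\mathcal{O}}\varphi_z(n+1)$ for all $n$, then $3\cdot5^z\in\mathcal{O}$ denotes the supremum of the ordinals denoted by the $\varphi_z(n)$, with $\varphi_z(n)<_{\mathcal O}3\cdot 5^z$ for all $n$; and $<_{\mathcal{O}}$ is the least transitive relation so obtained. $H_a$ for $a\in\mathcal{O}$ is the usual iteration of the Turing jump along $a$: $H_1=\emptyset$, $H_{2^a}=(H_a)'$ (the Turing jump), $H_{3\cdot5^z}=\{\langle x,n\rangle: x\in H_{\varphi_z(n)}\}$. For families $B,B'$ of finite subsets of $\mathbb{N}$, $B*B'=\{s\cup t: s\in B,\ t\in B',\ \max(s)<\min(t)\}$ (the condition $\max(s)<\min(t)$ being vacuous if $s$ or $t$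 is empty). The canonical barriers $B_a$, $a\in\mathcal{O}$, are defined by: $B_1=\{\emptyset\}$; $B_2=\{\{n\}:n\in\mathbb{N}\}$; $B_{2^a}=B_2*B_a$; $B_{3\cdot5^z}=\bigcup_{n\in\mathbb{N}}\{\{n\}\}*B_{\varphi_z(n)}*B_{\varphi_z(n-1)}*\cdots*B_{\varphi_z(0)}$.
   Formalization: The notation a = 1 is excluded: there B_2*B_1 = B_2 and H_1 = ∅, and for every 2-bounded computable f the set {n : f({m}) ≠ f({n}) for all m < n} is an infinite computable rainbow, so the claim fails. -}

module Defs where

open import Data.List using (List; []; _∷_; _++_; [_])
open import Data.List.Relation.Unary.All using (All; []; _∷_)
open import Data.List.Relation.Unary.AllPairs using (AllPairs; []; _∷_)
import Data.List.Relation.Unary.AllPairs.Properties as AllPairs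
open import Data.Nat using (ℕ; zero; suc; _+_; _*_; _^_; _≤_; _<_)
open import Data.Nat.Properties using (+-suc; +-identityʳ; suc-injective)
open import Data.Product using (∃; ∃-syntax; _×_; _,_; proj₁; proj₂; uncurry)
open import Data.Sum using (_⊎_)
open import Level using (0ℓ)
open import Relation.Binary.PropositionalEquality
  using (_≡_; refl; trans; cong)
open import Relation.Nullary using (¬_)
open import Relation.Unary using (Pred; ∅)

------------------------------------------------------------------------
-- Cantor pairing

triangle : ℕ → ℕ
triangle zero    = 0
triangle (suc n) = suc n + triangle n

⟨_,_⟩ : ℕ → ℕ → ℕ
⟨ x , y ⟩ = x + triangle (x + y)

next : ℕ × ℕ → ℕ × ℕ
next (x , zero)  = 0 , suc x
next (x , suc y) = suc x , y

-- ℕ × ℕ is traversed antidiagonal by antidiagonal.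
unpair : ℕ → ℕ × ℕ
unpair zero    = 0 , 0
unpair (suc n) = next (unpair n)

next-pair : ∀ p → uncurry ⟨_,_⟩ (next p) ≡ suc (uncurry ⟨_,_⟩ p)
next-pair (x , zero)  rewrite +-identityʳ x = refl
next-pair (x , suc y) rewrite +-suc x y     = refl

pair-unpair : ∀ n → uncurry ⟨_,_⟩ (unpair n) ≡ n
pair-unpair zero    = refl
pair-unpair (suc n) = trans (next-pair (unpair n)) (cong suc (pair-unpair n))

unpair-pair : ∀ x y → unpair ⟨ x , y ⟩ ≡ (x , y)
unpair-pair x y = go (x + y) x y refl
  where
  go : ∀ d x y → x + y ≡ d → unpair ⟨ x , y ⟩ ≡ (x , y)
  go d       (suc x) y       eq =
    trans (cong unpair (next-pair (x , suc y)))
          (cong next (go d x (suc y) (trans (+-suc x y) eq)))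
  go zero    zero    zero    eq = refl
  go (suc d) zero    (suc y) eq =
    trans (cong unpair (next-pair (y , zero)))
          (cong next (go d y zero (trans (+-identityʳ y) (suc-injective eq))))

------------------------------------------------------------------------
-- Partial recursive functions relative to an oracle

-- A partial function is given by its graph.
_⇀_ : Set → Set → Set₁
A ⇀ B = A → B → Set

-- The characteristic function; its totality is the decidability of A.
χ : Pred ℕ 0ℓ → ℕ ⇀ ℕ
χ A n m = (A n × m ≡ 1) ⊎ (¬ A n × m ≡ 0)

data Code : Set where
  zeroᶜ succᶜ leftᶜ rightᶜ oracleᶜ : Code
  pairᶜ compᶜ precᶜ                : Code → Code → Code
  muᶜ                              : Code → Code

primRec : (ℕ ⇀ ℕ) → (ℕ ⇀ ℕ) → ℕ → ℕ ⇀ ℕ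
primRec F G a zero    m = F a m
primRec F G a (suc n) m = ∃[ r ] primRec F G a n r × G ⟨ a , ⟨ n , r ⟩ ⟩ m

minimize : (ℕ ⇀ ℕ) → ℕ ⇀ ℕ
minimize F a m = F ⟨ a , m ⟩ 0 × (∀ i → i < m → ∃[ k ] F ⟨ a , i ⟩ (suc k))

eval : Pred ℕ 0ℓ → Code → ℕ ⇀ ℕ
eval A zeroᶜ       n m = m ≡ 0
eval A succᶜ       n m = m ≡ suc n
eval A leftᶜ       n m = m ≡ proj₁ (unpair n)
eval A rightᶜ      n m = m ≡ proj₂ (unpair n)
eval A oracleᶜ     n m = χ A n m
eval A (pairᶜ c d) n m = ∃[ x ] ∃[ y ] eval A c n x × eval A d n y × m ≡ ⟨ x , y ⟩
eval A (compᶜ c d) n m = ∃[ k ] eval A d n k × eval A c k m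
eval A (precᶜ c d) n m =
  primRec (eval A c) (eval A d) (proj₁ (unpair n)) (proj₂ (unpair n)) m
eval A (muᶜ c)     n m = minimize (eval A c) n m

encode : Code → ℕ
encode zeroᶜ       = ⟨ 0 , 0 ⟩
encode succᶜ       = ⟨ 1 , 0 ⟩
encode leftᶜ       = ⟨ 2 , 0 ⟩
encode rightᶜ      = ⟨ 3 , 0 ⟩
encode oracleᶜ     = ⟨ 4 , 0 ⟩
encode (pairᶜ c d) = ⟨ 5 , ⟨ encode c , encode d ⟩ ⟩
encode (compᶜ c d) = ⟨ 6 , ⟨ encode c , encode d ⟩ ⟩
encode (precᶜ c d) = ⟨ 7 , ⟨ encode c , encode d ⟩ ⟩
encode (muᶜ c)     = ⟨ 8 , encode c ⟩

-- The z-th partial A-computable function; it is nowhere defined when z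
-- encodes no program.
Φ : Pred ℕ 0ℓ → ℕ → ℕ ⇀ ℕ
Φ A z n m = ∃[ c ] encode c ≡ z × eval A c n m

φ : ℕ → ℕ ⇀ ℕ
φ = Φ ∅

jump : Pred ℕ 0ℓ → Pred ℕ 0ℓ
jump A e = ∃[ m ] Φ A e e m

-- Φ A e extends χ X.  Asking for χ X to be total as well would make no
-- difference classically, but would constructively restrict X to be
-- decidable.
_≤ᵀ_ : Pred ℕ 0ℓ → Pred ℕ 0ℓ → Set
X ≤ᵀ A = ∃[ e ] (∀ n m → χ X n m → Φ A e n m)

------------------------------------------------------------------------
-- Kleene's 𝒪

data 𝒪 : ℕ → Set
data _<𝒪_ : ℕ → ℕ → Set

data 𝒪 where
  one  : 𝒪 1
  succ : ∀ {a} → 𝒪 a → 𝒪 (2 ^ a)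
  lim  : ∀ {z} (g : ℕ → ℕ) →
         (∀ n → φ z n (g n)) →
         (∀ n → 𝒪 (g n)) →
         (∀ n → g n <𝒪 g (suc n)) →
         𝒪 (3 * 5 ^ z)

data _<𝒪_ where
  <-succ  : ∀ {a} → 𝒪 a → a <𝒪 (2 ^ a)
  <-lim   : ∀ {z n b} → 𝒪 (3 * 5 ^ z) → φ z n b → b <𝒪 (3 * 5 ^ z)
  <-trans : ∀ {a b c} → a <𝒪 b → b <𝒪 c → a <𝒪 c

-- Elements of 𝒪 are positive, so 1, 2 ^ a and 3 * 5 ^ z are never equal
-- and recursion on the derivation of a ∈ 𝒪 is recursion on the notation a.
H : ∀ {a} → 𝒪 a → Pred ℕ 0ℓ
H one           = ∅
H (succ p)      = jump (H p)
H (lim g _ p _) = λ k → H (p (proj₂ (unpair k))) (proj₁ (unpair k))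

------------------------------------------------------------------------
-- Families of finite sets and the canonical barriers

-- A finite set of naturals is represented by its strictly increasing
-- enumeration.
FinSet : Set
FinSet = List ℕ

Family : Set₁
Family = Pred FinSet 0ℓ

_≪_ : FinSet → FinSet → Set
s ≪ t = All (λ x → All (x <_) t) s

-- When s ≪ t, the enumeration of s ∪ t is s ++ t.
_⋆_ : Family → Family → Family
(B ⋆ B′) u = ∃[ s ] ∃[ t ] B s × B′ t × s ≪ t × u ≡ s ++ t

infixr 6 _⋆_

⦅_⦆ : FinSet → Family
⦅ s ⦆ = s ≡_

B₁ : Family
B₁ = ⦅ [] ⦆

B₂ : Family
B₂ s = ∃[ n ] s ≡ [ n ]

-- descending F n  =  F n ⋆ F (n - 1) ⋆ ⋯ ⋆ F 0
descending : (ℕ → Family) → ℕ → Family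
descending F zero    = F zero
descending F (suc n) = F (suc n) ⋆ descending F n

-- The clause for 2 ^ a also covers the notation 2 = 2 ^ 1, as B₂ ⋆ B₁ and
-- B₂ have the same members.
B : ∀ {a} → 𝒪 a → Family
B one           = B₁
B (succ p)      = B₂ ⋆ B p
B (lim g _ p _) = λ s → ∃[ n ] (⦅ [ n ] ⦆ ⋆ descending (λ i → B (p i)) n) s

Increasing : Family
Increasing = AllPairs _<_

⋆-increasing : ∀ {F G : Family} →
               (∀ {s} → F s → Increasing s) → (∀ {s} → G s → Increasing s) →
               ∀ {s} → (F ⋆ G) s → Increasing s
⋆-increasing f g (s , t , Fs , Gt , s≪t , refl) = AllPairs.++⁺ (f Fs) (g Gt) s≪t

B₂-increasing : ∀ {s} → B₂ s → Increasing s
B₂-increasing (n , refl) = [] ∷ []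

descending-increasing : ∀ {F : ℕ → Family} → (∀ i {s} → F i s → Increasing s) →
                        ∀ n {s} → descending F n s → Increasing s
descending-increasing f zero    = f zero
descending-increasing f (suc n) = ⋆-increasing (f (suc n)) (descending-increasing f n)

B-increasing : ∀ {a} (p : 𝒪 a) {s} → B p s → Increasing s
B-increasing one           refl    = []
B-increasing (succ p)      s∈      = ⋆-increasing B₂-increasing (B-increasing p) s∈
B-increasing (lim g _ p _) (n , s∈) =
  ⋆-increasing (λ { refl → [] ∷ [] })
               (descending-increasing (λ i → B-increasing (p i)) n) s∈

------------------------------------------------------------------------
-- Functions on a family of finite sets

⌜_⌝ : FinSet → ℕ
⌜ [] ⌝    = 0
⌜ x ∷ s ⌝ = suc ⟨ x , ⌜ s ⌝ ⟩

-- Since φ z is single-valued, a computable f does not depend on the proof of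
-- membership in D.
Computable : {D : Family} → (∃ D → ℕ) → Set
Computable {D} f = ∃[ z ] (∀ (s : ∃ D) → φ z ⌜ proj₁ s ⌝ (f s))

TwoBounded : {D : Family} → (∃ D → ℕ) → Set
TwoBounded {D} f = ∀ (s t u : ∃ D) → f s ≡ f t → f t ≡ f u →
  proj₁ s ≡ proj₁ t ⊎ proj₁ s ≡ proj₁ u ⊎ proj₁ t ≡ proj₁ u

Infinite : Pred ℕ 0ℓ → Set
Infinite X = ¬ (∃[ b ] (∀ n → X n → n ≤ b))

_⊑_ : FinSet → Pred ℕ 0ℓ → Set
s ⊑ X = All X s

Rainbow : {D : Family} → (∃ D → ℕ) → Pred ℕ 0ℓ → Set
Rainbow {D} f X = ∀ (s t : ∃ D) → proj₁ s ⊑ X → proj₁ t ⊑ X →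
  f s ≡ f t → proj₁ s ≡ proj₁ t

{-# OPTIONS --safe #-}

-- A member s of B p approximates H p: read from the right, each number n of s
-- that belongs to a successor bounds a search for halting computations, run
-- relative to the finite table obtained so far.  By induction on p, every
-- infinite X has a subset s in B p, as far out as desired, whose table agrees
-- with H p on any prescribed initial segment.
--
-- Given s, each e < min s in turn looks for the least certificate ≤ min s
-- which shows, relative to the table of s, that two numbers x < y not used
-- before belong to the e-th set; {x} ∪ s and {y} ∪ s then get the same color,
-- and this is the only way in which colors coincide.  If X is the e-th set
-- computable in H p, take 2e + 2 elements of X and one certificate for all of
-- them, and s ⊆ X whose table is correct beyond that certificate.  At most 2e
-- numbers are used before e is treated, so a pair is found for e; as its
-- certificate is correct, the pair lies in X.

module Submission where

open import Defs hiding (<-trans)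
open import Data.Empty using (⊥-elim)
open import Data.Fin using (Fin; zero; suc; #_)
open import Data.List using (List; []; _∷_; _++_; [_]; length)
open import Data.List.Membership.Propositional using (_∈_)
open import Data.List.Properties using (++-assoc; ++-identityʳ; ∷-injectiveˡ)
open import Data.List.Relation.Binary.Subset.Propositional using (_⊆_)
open import Data.List.Relation.Unary.All as All using (All; []; _∷_)
open import Data.List.Relation.Unary.All.Properties using (++⁺)
open import Data.List.Relation.Unary.AllPairs using ([]; _∷_)
open import Data.List.Relation.Unary.Any using (here; there)
open import Data.Nat
  using (ℕ; zero; suc; pred; _+_; _*_; _∸_; _^_; _≤_; _<_; _⊔_; ∣_-_∣; z≤n; s≤s; s≤s⁻¹)
open import Data.Nat.DivMod using (_%_; %-distribˡ-*; m*n%n≡0)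
open import Data.Nat.Induction using (<-rec)
open import Data.Nat.Properties
open import Data.List.Membership.DecPropositional _≟_ using (_∈?_)
open import Data.Product using (∃; ∃-syntax; _×_; _,_; proj₁; proj₂)
open import Data.Sum using (_⊎_; inj₁; inj₂)
open import Data.Unit using (⊤; tt)
open import Data.Vec using (Vec; []; _∷_; lookup)
open import Level using (0ℓ)
open import Relation.Binary.Definitions using (tri<; tri≈; tri>)
open import Relation.Binary.PropositionalEquality
  using (_≡_; _≢_; refl; sym; trans; cong; cong₂; subst; subst₂)
open import Relation.Nullary using (¬_; yes; no)
open import Relation.Nullary.Decidable using (¬¬-excluded-middle)
open import Relation.Unary using (Pred; ∅)


-- Pairing and coded lists

-- Opaque, so that unpair is not unfolded on the numerals used as tags.
opaque
  π : ℕ → ℕ → ℕ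
  π = ⟨_,_⟩

  left right : ℕ → ℕ
  left n  = proj₁ (unpair n)
  right n = proj₂ (unpair n)

  left-π : ∀ x y → left (π x y) ≡ x
  left-π x y = cong proj₁ (unpair-pair x y)

  right-π : ∀ x y → right (π x y) ≡ y
  right-π x y = cong proj₂ (unpair-pair x y)

  π-left-right : ∀ n → π (left n) (right n) ≡ n
  π-left-right = pair-unpair

  x≤π : ∀ x y → x ≤ π x y
  x≤π x y = m≤m+n x _

  y≤π : ∀ x y → y ≤ π x y
  y≤π x y = ≤-trans (m≤n+m y x) (≤-trans (n≤triangle (x + y)) (m≤n+m _ x))
    where
    n≤triangle : ∀ n → n ≤ triangle n
    n≤triangle zero    = z≤n
    n≤triangle (suc n) = m≤m+n (suc n) _

  π-mono-≤ : ∀ {x x′ y y′} → x ≤ x′ → y ≤ y′ → π x y ≤ π x′ y′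
  π-mono-≤ p q = +-mono-≤ p (triangle-mono (+-mono-≤ p q))
    where
    triangle-mono : ∀ {m n} → m ≤ n → triangle m ≤ triangle n
    triangle-mono z≤n     = z≤n
    triangle-mono (s≤s p) = +-mono-≤ (s≤s p) (triangle-mono p)

π-injective : ∀ {x y x′ y′} → π x y ≡ π x′ y′ → x ≡ x′ × y ≡ y′
π-injective {x} {y} {x′} {y′} eq =
  trans (sym (left-π x y)) (trans (cong left eq) (left-π x′ y′)) ,
  trans (sym (right-π x y)) (trans (cong right eq) (right-π x′ y′))

left≤ : ∀ n → left n ≤ n
left≤ n = subst (left n ≤_) (π-left-right n) (x≤π _ _)

right≤ : ∀ n → right n ≤ n
right≤ n = subst (right n ≤_) (π-left-right n) (y≤π _ _)

code : List ℕ → ℕ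
code []      = 0
code (x ∷ l) = suc (π x (code l))

head tail : ℕ → ℕ
head w = left (pred w)
tail w = right (pred w)

head-code : ∀ x l → head (code (x ∷ l)) ≡ x
head-code x l = left-π x (code l)

tail-code : ∀ x l → tail (code (x ∷ l)) ≡ code l
tail-code x l = right-π x (code l)

opaque
  unfolding π

  code≡⌜⌝ : ∀ l → code l ≡ ⌜ l ⌝
  code≡⌜⌝ []      = refl
  code≡⌜⌝ (x ∷ l) = cong (λ w → suc (π x w)) (code≡⌜⌝ l)

head<code : ∀ x l → x < code (x ∷ l)
head<code x l = s≤s (x≤π x (code l))

tail<code : ∀ x l → code l < code (x ∷ l)
tail<code x l = s≤s (y≤π x (code l))

length≤code : ∀ l → length l ≤ code l
length≤code []      = z≤n
length≤code (x ∷ l) = ≤-trans (s≤s (length≤code l)) (tail<code x l)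

code-surjective : ∀ w → ∃[ l ] code l ≡ w
code-surjective = <-rec _ λ where
  zero    rec → [] , refl
  (suc v) rec → let l , eq = rec (s≤s (right≤ v)) in
    left v ∷ l , cong suc (trans (cong (π (left v)) eq) (π-left-right v))

code-injective : ∀ {l l′} → code l ≡ code l′ → l ≡ l′
code-injective {[]}    {[]}     eq = refl
code-injective {x ∷ l} {y ∷ l′} eq = cong₂ _∷_
  (trans (sym (head-code x l)) (trans (cong head eq) (head-code y l′)))
  (code-injective (trans (sym (tail-code x l)) (trans (cong tail eq) (tail-code y l′))))


-- Programs

data Runs (A : Pred ℕ 0ℓ) : Code → ℕ → ℕ → Set where
  zeroʳ   : ∀ {n} → Runs A zeroᶜ n 0
  succʳ   : ∀ {n} → Runs A succᶜ n (suc n)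
  leftʳ   : ∀ {n} → Runs A leftᶜ n (left n)
  rightʳ  : ∀ {n} → Runs A rightᶜ n (right n)
  oracleʳ : ∀ {n m} → χ A n m → Runs A oracleᶜ n m
  pairʳ   : ∀ {c d n x y} → Runs A c n x → Runs A d n y → Runs A (pairᶜ c d) n (π x y)
  compʳ   : ∀ {c d n k m} → Runs A d n k → Runs A c k m → Runs A (compᶜ c d) n m
  prec₀ʳ  : ∀ {c d n m} → right n ≡ 0 → Runs A c (left n) m → Runs A (precᶜ c d) n m
  precₛʳ  : ∀ {c d n i r m} → right n ≡ suc i → Runs A (precᶜ c d) (π (left n) i) r →
            Runs A d (π (left n) (π i r)) m → Runs A (precᶜ c d) n m
  muʳ     : ∀ {c n m} → Runs A c (π n m) 0 →
            (∀ i → i < m → ∃[ k ] Runs A c (π n i) (suc k)) → Runs A (muᶜ c) n m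

opaque
  unfolding π

  eval⇒runs : ∀ {A} c {n m} → eval A c n m → Runs A c n m
  eval⇒runs zeroᶜ   refl = zeroʳ
  eval⇒runs succᶜ   refl = succʳ
  eval⇒runs leftᶜ   refl = leftʳ
  eval⇒runs rightᶜ  refl = rightʳ
  eval⇒runs oracleᶜ p    = oracleʳ p
  eval⇒runs (pairᶜ c d) (x , y , p , q , refl) = pairʳ (eval⇒runs c p) (eval⇒runs d q)
  eval⇒runs (compᶜ c d) (k , p , q) = compʳ (eval⇒runs d p) (eval⇒runs c q)
  eval⇒runs {A} (precᶜ c d) {n} p =
    subst (λ n → Runs A (precᶜ c d) n _) (pair-unpair n) (go (proj₂ (unpair n)) p)
    where
    go : ∀ {a} n {m} → primRec (eval A c) (eval A d) a n m → Runs A (precᶜ c d) (π a n) m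
    go {a} zero p = prec₀ʳ (right-π a 0)
      (subst (λ b → Runs A c b _) (sym (left-π a 0)) (eval⇒runs c p))
    go {a} (suc n) (r , p , q) = precₛʳ (right-π a (suc n))
      (subst (λ b → Runs A (precᶜ c d) (π b n) r) (sym (left-π a (suc n))) (go n p))
      (subst (λ b → Runs A d (π b (π n r)) _) (sym (left-π a (suc n))) (eval⇒runs d q))
  eval⇒runs (muᶜ c) (p , q) = muʳ (eval⇒runs c p) λ i i<m →
    proj₁ (q i i<m) , eval⇒runs c (proj₂ (q i i<m))

  runs⇒eval : ∀ {A c n m} → Runs A c n m → eval A c n m
  runs⇒eval zeroʳ       = refl
  runs⇒eval succʳ       = refl
  runs⇒eval leftʳ       = refl
  runs⇒eval rightʳ      = refl
  runs⇒eval (oracleʳ p) = p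
  runs⇒eval (pairʳ p q) = _ , _ , runs⇒eval p , runs⇒eval q , refl
  runs⇒eval (compʳ p q) = _ , runs⇒eval p , runs⇒eval q
  runs⇒eval {A} {precᶜ c d} {n} {m} (prec₀ʳ eq p) =
    subst (λ k → primRec (eval A c) (eval A d) (left n) k m) (sym eq) (runs⇒eval p)
  runs⇒eval {A} {precᶜ c d} {n} {m} (precₛʳ {i = i} {r} eq p q) =
    subst (λ k → primRec (eval A c) (eval A d) (left n) k m) (sym eq)
      (r , subst (λ u → primRec (eval A c) (eval A d) (proj₁ u) (proj₂ u) r)
             (unpair-pair (left n) i) (runs⇒eval p)
         , runs⇒eval q)
  runs⇒eval (muʳ p q) = runs⇒eval p , λ i i<m → proj₁ (q i i<m) , runs⇒eval (proj₂ (q i i<m))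

runs-deterministic : ∀ {A c n m m′} → Runs A c n m → Runs A c n m′ → m ≡ m′
runs-deterministic zeroʳ  zeroʳ  = refl
runs-deterministic succʳ  succʳ  = refl
runs-deterministic leftʳ  leftʳ  = refl
runs-deterministic rightʳ rightʳ = refl
runs-deterministic (oracleʳ (inj₁ (p , refl))) (oracleʳ (inj₁ (q , refl))) = refl
runs-deterministic (oracleʳ (inj₁ (p , refl))) (oracleʳ (inj₂ (q , refl))) = ⊥-elim (q p)
runs-deterministic (oracleʳ (inj₂ (p , refl))) (oracleʳ (inj₁ (q , refl))) = ⊥-elim (p q)
runs-deterministic (oracleʳ (inj₂ (p , refl))) (oracleʳ (inj₂ (q , refl))) = refl
runs-deterministic (pairʳ p q) (pairʳ p′ q′) =
  cong₂ π (runs-deterministic p p′) (runs-deterministic q q′)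
runs-deterministic (compʳ p q) (compʳ p′ q′) with refl ← runs-deterministic p p′ =
  runs-deterministic q q′
runs-deterministic (prec₀ʳ _ p) (prec₀ʳ _ p′) = runs-deterministic p p′
runs-deterministic (prec₀ʳ e p) (precₛʳ e′ _ _) with () ← trans (sym e) e′
runs-deterministic (precₛʳ e _ _) (prec₀ʳ e′ _) with () ← trans (sym e) e′
runs-deterministic (precₛʳ e p q) (precₛʳ e′ p′ q′)
  with refl ← suc-injective (trans (sym e) e′)
  with refl ← runs-deterministic p p′ = runs-deterministic q q′
runs-deterministic (muʳ {m = m} p q) (muʳ {m = m′} p′ q′) with <-cmp m m′
... | tri< m<m′ _ _ with () ← runs-deterministic p (proj₂ (q′ m m<m′))
... | tri≈ _ eq _ = eq
... | tri> _ _ m>m′ with () ← runs-deterministic p′ (proj₂ (q m′ m>m′))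


-- Total programs in an environment of numbers

env : ∀ {k} → Vec ℕ k → ℕ
env []      = 0
env (x ∷ ρ) = π x (env ρ)

idᶜ : Code
idᶜ = pairᶜ leftᶜ rightᶜ

runs-id : ∀ {n} → Runs ∅ idᶜ n n
runs-id {n} = subst (Runs ∅ idᶜ n) (π-left-right n) (pairʳ leftʳ rightʳ)

runs-left : ∀ {x y} → Runs ∅ leftᶜ (π x y) x
runs-left {x} {y} = subst (Runs ∅ leftᶜ _) (left-π x y) leftʳ

runs-right : ∀ {x y} → Runs ∅ rightᶜ (π x y) y
runs-right {x} {y} = subst (Runs ∅ rightᶜ _) (right-π x y) rightʳ

letᶜ : Code → Code → Code
letᶜ c d = compᶜ d (pairᶜ c idᶜ)

runs-let : ∀ {c d n v m} → Runs ∅ c n v → Runs ∅ d (π v n) m → Runs ∅ (letᶜ c d) n m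
runs-let p q = compʳ (pairʳ p runs-id) q

shuffleᶜ : Code
shuffleᶜ = pairᶜ (compᶜ leftᶜ rightᶜ) (pairᶜ (compᶜ rightᶜ rightᶜ) leftᶜ)

runs-shuffle : ∀ {y j r} → Runs ∅ shuffleᶜ (π y (π j r)) (π j (π r y))
runs-shuffle = pairʳ (compʳ runs-right runs-left) (pairʳ (compʳ runs-right runs-right) runs-left)

-- The body of the loop runs in the environment j ∷ r ∷ ρ, where j counts the
-- iterations already done and r is the current value.
loopᶜ : Code → Code → Code
loopᶜ c d = precᶜ c (compᶜ d shuffleᶜ)

runs-loop₀ : ∀ {c d y m} → Runs ∅ c y m → Runs ∅ (loopᶜ c d) (π y 0) m
runs-loop₀ {c} {y = y} p = prec₀ʳ (right-π y 0) (subst (λ n → Runs ∅ c n _) (sym (left-π y 0)) p)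

runs-loopₛ : ∀ {c d y j r m} → Runs ∅ (loopᶜ c d) (π y j) r → Runs ∅ d (π j (π r y)) m →
             Runs ∅ (loopᶜ c d) (π y (suc j)) m
runs-loopₛ {c} {d} {y} {j} {r} p q = precₛʳ (right-π y (suc j))
  (subst (λ n → Runs ∅ (loopᶜ c d) (π n j) r) (sym (left-π y (suc j))) p)
  (subst (λ n → Runs ∅ _ (π n (π j r)) _) (sym (left-π y (suc j))) (compʳ runs-shuffle q))

loop : ℕ → (ℕ → ℕ → ℕ) → ℕ → ℕ
loop z s zero    = z
loop z s (suc n) = s n (loop z s n)

cond : ℕ → ℕ → ℕ → ℕ
cond zero    x y = x
cond (suc _) x y = y

record Term (k : ℕ) : Set where
  field
    fn      : Vec ℕ k → ℕ
    program : Code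
    correct : ∀ ρ → Runs ∅ program (env ρ) (fn ρ)

open Term

var : ∀ {k} → Fin k → Term k
var i .fn ρ             = lookup ρ i
var zero .program       = leftᶜ
var (suc i) .program    = compᶜ (program (var i)) rightᶜ
var zero .correct (x ∷ ρ)    = runs-left
var (suc i) .correct (x ∷ ρ) = compʳ runs-right (correct (var i) ρ)

succᵗ : ∀ {k} → Term k → Term k
succᵗ a .fn ρ      = suc (fn a ρ)
succᵗ a .program   = compᶜ succᶜ (program a)
succᵗ a .correct ρ = compʳ (correct a ρ) succʳ

nat : ∀ {k} → ℕ → Term k
nat n .fn ρ               = n
nat zero .program         = zeroᶜ
nat (suc n) .program      = compᶜ succᶜ (program (nat {0} n))
nat zero .correct ρ       = zeroʳ
nat {k} (suc n) .correct ρ = compʳ (go n) succʳ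
  where
  go : ∀ n → Runs ∅ (program (nat {0} n)) (env ρ) n
  go zero    = zeroʳ
  go (suc n) = compʳ (go n) succʳ

πᵗ : ∀ {k} → Term k → Term k → Term k
πᵗ a b .fn ρ      = π (fn a ρ) (fn b ρ)
πᵗ a b .program   = pairᶜ (program a) (program b)
πᵗ a b .correct ρ = pairʳ (correct a ρ) (correct b ρ)

leftᵗ rightᵗ : ∀ {k} → Term k → Term k
leftᵗ a .fn ρ       = left (fn a ρ)
leftᵗ a .program    = compᶜ leftᶜ (program a)
leftᵗ a .correct ρ  = compʳ (correct a ρ) leftʳ
rightᵗ a .fn ρ      = right (fn a ρ)
rightᵗ a .program   = compᶜ rightᶜ (program a)
rightᵗ a .correct ρ = compʳ (correct a ρ) rightʳ

letᵗ : ∀ {k} → Term k → Term (suc k) → Term k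
letᵗ a b .fn ρ      = fn b (fn a ρ ∷ ρ)
letᵗ a b .program   = letᶜ (program a) (program b)
letᵗ a b .correct ρ = runs-let (correct a ρ) (correct b (fn a ρ ∷ ρ))

loopᵗ : ∀ {k} → Term k → Term k → Term (suc (suc k)) → Term k
loopᵗ n z s .fn ρ      = loop (fn z ρ) (λ j r → fn s (j ∷ r ∷ ρ)) (fn n ρ)
loopᵗ n z s .program   = compᶜ (loopᶜ (program z) (program s)) (pairᶜ idᶜ (program n))
loopᵗ n z s .correct ρ = compʳ (pairʳ runs-id (correct n ρ)) (go (fn n ρ))
  where
  go : ∀ m → Runs ∅ (loopᶜ (program z) (program s)) (π (env ρ) m)
               (loop (fn z ρ) (λ j r → fn s (j ∷ r ∷ ρ)) m)
  go zero    = runs-loop₀ (correct z ρ)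
  go (suc m) = runs-loopₛ (go m) (correct s (m ∷ _ ∷ ρ))

condᵗ : ∀ {k} → Term k → Term k → Term k → Term k
condᵗ c a b .fn ρ      = cond (fn c ρ) (fn a ρ) (fn b ρ)
condᵗ c a b .program   =
  compᶜ (precᶜ leftᶜ (compᶜ rightᶜ leftᶜ)) (pairᶜ (pairᶜ (program a) (program b)) (program c))
condᵗ c a b .correct ρ =
  compʳ (pairʳ (pairʳ (correct a ρ) (correct b ρ)) (correct c ρ)) (go (fn c ρ))
  where
  P = precᶜ leftᶜ (compᶜ rightᶜ leftᶜ)
  go : ∀ {x y} n → Runs ∅ P (π (π x y) n) (cond n x y)
  go {x} {y} zero = prec₀ʳ (right-π _ _)
    (subst (λ n → Runs ∅ leftᶜ n x) (sym (left-π (π x y) 0)) runs-left)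
  go {x} {y} (suc n) = precₛʳ {r = cond n x y} (right-π _ _)
    (subst (λ u → Runs ∅ P (π u n) (cond n x y)) (sym (left-π (π x y) (suc n))) (go n))
    (subst (λ u → Runs ∅ (compᶜ rightᶜ leftᶜ) (π u (π n (cond n x y))) y) (sym (left-π (π x y) (suc n)))
      (compʳ runs-left runs-right))

data Args (k : ℕ) : ℕ → Set where
  []  : Args k 0
  _∷_ : ∀ {m} → Term k → Args k m → Args k (suc m)

evalArgs : ∀ {k m} → Args k m → Vec ℕ k → Vec ℕ m
evalArgs []       ρ = []
evalArgs (a ∷ as) ρ = fn a ρ ∷ evalArgs as ρ

argsᶜ : ∀ {k m} → Args k m → Code
argsᶜ []       = zeroᶜ
argsᶜ (a ∷ as) = pairᶜ (program a) (argsᶜ as)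

runs-args : ∀ {k m} (as : Args k m) ρ → Runs ∅ (argsᶜ as) (env ρ) (env (evalArgs as ρ))
runs-args []       ρ = zeroʳ
runs-args (a ∷ as) ρ = pairʳ (correct a ρ) (runs-args as ρ)

call : ∀ {k m} → Term m → Args k m → Term k
call t as .fn ρ      = fn t (evalArgs as ρ)
call t as .program   = compᶜ (program t) (argsᶜ as)
call t as .correct ρ = compʳ (runs-args as ρ) (correct t (evalArgs as ρ))

wk₀ : ∀ {k} → Term k → Term (suc k)
wk₀ t .fn (x ∷ ρ)      = fn t ρ
wk₀ t .program         = compᶜ (program t) rightᶜ
wk₀ t .correct (x ∷ ρ) = compʳ runs-right (correct t ρ)

wk₁ : ∀ {k} → Term (suc k) → Term (suc (suc k))
wk₁ t .fn (x ∷ y ∷ ρ)      = fn t (x ∷ ρ)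
wk₁ t .program             = compᶜ (program t) (pairᶜ leftᶜ (compᶜ rightᶜ rightᶜ))
wk₁ t .correct (x ∷ y ∷ ρ) =
  compʳ (pairʳ runs-left (compʳ runs-right runs-right)) (correct t (x ∷ ρ))

retype : ∀ {k} (t : Term k) (g : Vec ℕ k → ℕ) → (∀ ρ → fn t ρ ≡ g ρ) → Term k
retype t g eq .fn        = g
retype t g eq .program   = program t
retype t g eq .correct ρ = subst (Runs ∅ (program t) (env ρ)) (eq ρ) (correct t ρ)

v₀ : ∀ {k} → Term (suc k)
v₀ = var zero

v₁ : ∀ {k} → Term (suc (suc k))
v₁ = var (suc zero)

predᵗ : ∀ {k} → Term k → Term k
predᵗ a = retype (loopᵗ a (nat 0) v₀) (λ ρ → pred (fn a ρ)) (λ ρ → go (fn a ρ))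
  where
  go : ∀ n → loop 0 (λ j _ → j) n ≡ pred n
  go zero    = refl
  go (suc n) = refl

infixl 6 _+ᵗ_ _∸ᵗ_
infixl 7 _*ᵗ_

_+ᵗ_ _∸ᵗ_ _*ᵗ_ _^ᵗ_ distᵗ : ∀ {k} → Term k → Term k → Term k

a +ᵗ b = retype (loopᵗ a b (succᵗ v₁)) (λ ρ → fn a ρ + fn b ρ) (λ ρ → go (fn a ρ))
  where
  go : ∀ {n} m → loop n (λ _ → suc) m ≡ m + n
  go zero    = refl
  go (suc m) = cong suc (go m)

a ∸ᵗ b = retype (loopᵗ b a (predᵗ v₁)) (λ ρ → fn a ρ ∸ fn b ρ) (λ ρ → go (fn b ρ))
  where
  go : ∀ {m} n → loop m (λ _ → pred) n ≡ m ∸ n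
  go zero        = refl
  go {m} (suc n) = trans (cong pred (go n)) (pred[m∸n]≡m∸[1+n] m n)

a *ᵗ b = retype (loopᵗ a (nat 0) (wk₀ (wk₀ b) +ᵗ v₁)) (λ ρ → fn a ρ * fn b ρ) (λ ρ → go (fn a ρ))
  where
  go : ∀ {n} m → loop 0 (λ _ r → n + r) m ≡ m * n
  go zero        = refl
  go {n} (suc m) = cong (n +_) (go m)

a ^ᵗ b = retype (loopᵗ b (nat 1) (wk₀ (wk₀ a) *ᵗ v₁)) (λ ρ → fn a ρ ^ fn b ρ) (λ ρ → go (fn b ρ))
  where
  go : ∀ {m} n → loop 1 (λ _ r → m * r) n ≡ m ^ n
  go zero        = refl
  go {m} (suc n) = cong (m *_) (go n)

distᵗ a b = retype ((a ∸ᵗ b) +ᵗ (b ∸ᵗ a)) (λ ρ → ∣ fn a ρ - fn b ρ ∣) (λ ρ → go (fn a ρ) (fn b ρ))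
  where
  go : ∀ m n → (m ∸ n) + (n ∸ m) ≡ ∣ m - n ∣
  go zero    zero    = refl
  go zero    (suc n) = refl
  go (suc m) zero    = +-identityʳ _
  go (suc m) (suc n) = go m n

headᵗ tailᵗ : ∀ {k} → Term k → Term k
headᵗ a = leftᵗ (predᵗ a)
tailᵗ a = rightᵗ (predᵗ a)

consᵗ : ∀ {k} → Term k → Term k → Term k
consᵗ a b = succᵗ (πᵗ a b)

-- Searching

-- Truth values: 0 is true, so that _+_ is conjunction and 1 ∸_ is negation.

search : (ℕ → ℕ) → ℕ → ℕ
search h = loop 0 (λ _ r → cond (h r) r (suc r))

searchᵗ : ∀ {k} → Term k → Term (suc k) → Term k
searchᵗ n c = loopᵗ n (nat 0) (condᵗ (wk₀ c) v₁ (succᵗ v₁))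

foundᵗ : ∀ {k} → Term k → Term (suc k) → Term k
foundᵗ n c = letᵗ (searchᵗ n c) c

module _ (h : ℕ → ℕ) where

  private
    search-invariant : ∀ n → (∀ i → i < search h n → h i ≢ 0) × (search h n ≡ n ⊎ h (search h n) ≡ 0)
    search-invariant zero = (λ _ ()) , inj₁ refl
    search-invariant (suc n) with search h n | search-invariant n
    ... | r | below , stop with h r in eq
    ...   | zero = below , inj₂ eq
    ...   | suc k with stop
    ...     | inj₁ refl = (λ i i≤r → below′ i (m≤n⇒m<n∨m≡n (s≤s⁻¹ i≤r))) , inj₁ refl
      where
      below′ : ∀ i → i < r ⊎ i ≡ r → h i ≢ 0
      below′ i (inj₁ i<r)  hi≡0 = below i i<r hi≡0
      below′ i (inj₂ refl) hi≡0 with () ← trans (sym eq) hi≡0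
    ...     | inj₂ ()

  search≤bound : ∀ n → search h n ≤ n
  search≤bound zero = z≤n
  search≤bound (suc n) with h (search h n)
  ... | zero  = m≤n⇒m≤1+n (search≤bound n)
  ... | suc _ = s≤s (search≤bound n)

  search-below : ∀ n i → i < search h n → h i ≢ 0
  search-below n = proj₁ (search-invariant n)

  search≤witness : ∀ n {w} → h w ≡ 0 → search h n ≤ w
  search≤witness n {w} hw≡0 = ≮⇒≥ λ w<s → search-below n w w<s hw≡0

  search-finds : ∀ n {w} → h w ≡ 0 → w ≤ n → h (search h n) ≡ 0
  search-finds n {w} hw≡0 w≤n with proj₂ (search-invariant n)
  ... | inj₂ eq = eq
  ... | inj₁ eq = subst (λ r → h r ≡ 0)
    (≤-antisym (≤-trans w≤n (≤-reflexive (sym eq))) (search≤witness n hw≡0)) hw≡0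

pick : ℕ → ℕ → List ℕ → List ℕ
pick zero    x l = x ∷ l
pick (suc _) x l = l

select : (ℕ → ℕ) → ℕ → List ℕ
select h zero    = []
select h (suc n) = pick (h n) n (select h n)

selectᵗ : ∀ {k} → Term k → Term (suc k) → Term k
selectᵗ n c = retype (loopᵗ n (nat 0) (condᵗ (wk₁ c) (consᵗ v₀ v₁) v₁))
  (λ ρ → code (select (λ j → fn c (j ∷ ρ)) (fn n ρ))) (λ ρ → go (λ j → fn c (j ∷ ρ)) (fn n ρ))
  where
  go : ∀ h n → loop 0 (λ j r → cond (h j) (suc (π j r)) r) n ≡ code (select h n)
  go h zero = refl
  go h (suc n) rewrite go h n with h n
  ... | zero  = refl
  ... | suc _ = refl

∈-select⁺ : ∀ h {n q} → q < n → h q ≡ 0 → q ∈ select h n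
∈-select⁺ h {suc n} {q} q<1+n hq≡0 with h n in eq | m≤n⇒m<n∨m≡n (s≤s⁻¹ q<1+n)
... | zero  | inj₁ q<n  = there (∈-select⁺ h q<n hq≡0)
... | zero  | inj₂ refl = here refl
... | suc _ | inj₁ q<n  = ∈-select⁺ h q<n hq≡0
... | suc _ | inj₂ refl with () ← trans (sym eq) hq≡0

∈-select⁻ : ∀ h n {q} → q ∈ select h n → h q ≡ 0
∈-select⁻ h (suc n) q∈ with h n in eq
∈-select⁻ h (suc n) (here refl) | zero  = eq
∈-select⁻ h (suc n) (there q∈)  | zero  = ∈-select⁻ h n q∈
∈-select⁻ h (suc n) q∈          | suc _ = ∈-select⁻ h n q∈

-- walk h w is the longest nonempty suffix r of the coded list w with h r ≡ 0,
-- and 0 if there is none.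
walk : (ℕ → ℕ) → ℕ → ℕ
walk h w = loop w (λ _ r → cond r r (cond (h r) r (tail r))) w

walkᵗ : ∀ {k} → Term k → Term (suc k) → Term k
walkᵗ w c = loopᵗ w w (condᵗ v₁ v₁ (condᵗ (wk₀ c) v₁ (tailᵗ v₁)))

loop-shift : ∀ (f : ℕ → ℕ) n z → loop z (λ _ → f) (suc n) ≡ loop (f z) (λ _ → f) n
loop-shift f zero    z = refl
loop-shift f (suc n) z = cong f (loop-shift f n z)

NoSuffix : (ℕ → ℕ) → List ℕ → Set
NoSuffix h []      = ⊤
NoSuffix h (x ∷ l) = h (code (x ∷ l)) ≢ 0 × NoSuffix h l

module _ (h : ℕ → ℕ) where

  private
    step : ℕ → ℕ
    step r = cond r r (cond (h r) r (tail r))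

    stuck : ∀ {r} → step r ≡ r → ∀ n → loop r (λ _ → step) n ≡ r
    stuck eq zero    = refl
    stuck eq (suc n) = trans (cong step (stuck eq n)) eq

  walk⁺ : ∀ {l} → NoSuffix h l → walk h (code l) ≡ 0
  walk⁺ {l} p = go l (code l) (length≤code l) p
    where
    go : ∀ l n → length l ≤ n → NoSuffix h l → loop (code l) (λ _ → step) n ≡ 0
    go []      n       _       _ = stuck refl n
    go (x ∷ l) (suc n) (s≤s q) (h≢0 , p) =
      trans (loop-shift step n (code (x ∷ l)))
        (trans (cong (λ r → loop r (λ _ → step) n) step≡) (go l n q p))
      where
      step≡ : step (code (x ∷ l)) ≡ code l
      step≡ with h (code (x ∷ l))
      ... | zero  = ⊥-elim (h≢0 refl)
      ... | suc _ = tail-code x l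

  walk⁻ : ∀ {l} → walk h (code l) ≡ 0 → NoSuffix h l
  walk⁻ {l} p = go l (code l) (length≤code l) p
    where
    go : ∀ l n → length l ≤ n → loop (code l) (λ _ → step) n ≡ 0 → NoSuffix h l
    go []      n       _       _ = tt
    go (x ∷ l) (suc n) (s≤s q) p with h (code (x ∷ l)) in eq
    ... | zero  with () ← trans (sym (stuck (cong (λ z → cond z (code (x ∷ l)) _) eq) (suc n))) p
    ... | suc k = (λ ()) , go l n q (trans (cong (λ r → loop r (λ _ → step) n) (sym step≡))
                                      (trans (sym (loop-shift step n (code (x ∷ l)))) p))
      where
      step≡ : step (code (x ∷ l)) ≡ code l
      step≡ rewrite eq = tail-code x l

opaque
  member : ℕ → ℕ → ℕ
  member x w = 1 ∸ walk (λ r → ∣ head r - x ∣) w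

  member≡ : ∀ x w → 1 ∸ walk (λ r → ∣ head r - x ∣) w ≡ member x w
  member≡ x w = refl

memberᵗ : ∀ {k} → Term k → Term k → Term k
memberᵗ a b = retype (call (nat 1 ∸ᵗ walkᵗ v₁ (distᵗ (headᵗ v₀) v₁)) (a ∷ b ∷ []))
  (λ ρ → member (fn a ρ) (fn b ρ)) (λ ρ → member≡ (fn a ρ) (fn b ρ))

∉⇒NoSuffix : ∀ {x} l → ¬ x ∈ l → NoSuffix (λ r → ∣ head r - x ∣) l
∉⇒NoSuffix     []      x∉ = tt
∉⇒NoSuffix {x} (y ∷ l) x∉ =
  (λ eq → x∉ (here (sym (trans (sym (head-code y l)) (∣m-n∣≡0⇒m≡n eq))))) ,
  ∉⇒NoSuffix l (λ p → x∉ (there p))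

NoSuffix⇒∉ : ∀ {x} l → NoSuffix (λ r → ∣ head r - x ∣) l → ¬ x ∈ l
NoSuffix⇒∉ (y ∷ l) (p , q) (here refl) = p (m≡n⇒∣m-n∣≡0 (head-code y l))
NoSuffix⇒∉ (y ∷ l) (p , q) (there x∈)  = NoSuffix⇒∉ l q x∈

opaque
  unfolding member

  member⁺ : ∀ {x l} → x ∈ l → member x (code l) ≡ 0
  member⁺ {x} {l} x∈ with walk (λ r → ∣ head r - x ∣) (code l) in eq
  ... | zero  = ⊥-elim (NoSuffix⇒∉ l (walk⁻ _ eq) x∈)
  ... | suc n = 0∸n≡0 n

  member⁻ : ∀ {x} l → member x (code l) ≡ 0 → x ∈ l
  member⁻ {x} l eq with x ∈? l
  ... | yes x∈ = x∈
  ... | no  x∉ with () ← trans (sym (cong (1 ∸_) (walk⁺ _ (∉⇒NoSuffix l x∉)))) eq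

  member-∉ : ∀ {x l} → ¬ x ∈ l → member x (code l) ≡ 1
  member-∉ {x} {l} x∉ = cong (1 ∸_) (walk⁺ _ (∉⇒NoSuffix l x∉))

-- Certificates for computations relative to a finite table

opaque
  unfolding π

  ♯ : Code → ℕ
  ♯ = encode

  ♯≡encode : ∀ c → ♯ c ≡ encode c
  ♯≡encode c = refl

  ♯-zero : ♯ zeroᶜ ≡ π 0 0
  ♯-zero = refl

  ♯-succ : ♯ succᶜ ≡ π 1 0
  ♯-succ = refl

  ♯-left : ♯ leftᶜ ≡ π 2 0
  ♯-left = refl

  ♯-right : ♯ rightᶜ ≡ π 3 0
  ♯-right = refl

  ♯-oracle : ♯ oracleᶜ ≡ π 4 0
  ♯-oracle = refl

  ♯-pair : ∀ c d → ♯ (pairᶜ c d) ≡ π 5 (π (♯ c) (♯ d))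
  ♯-pair c d = refl

  ♯-comp : ∀ c d → ♯ (compᶜ c d) ≡ π 6 (π (♯ c) (♯ d))
  ♯-comp c d = refl

  ♯-prec : ∀ c d → ♯ (precᶜ c d) ≡ π 7 (π (♯ c) (♯ d))
  ♯-prec c d = refl

  ♯-mu : ∀ c → ♯ (muᶜ c) ≡ π 8 (♯ c)
  ♯-mu c = refl

fact : ℕ → ℕ → ℕ → ℕ
fact e n m = π e (π n m)

factᵗ : ∀ {k} → Term k → Term k → Term k → Term k
factᵗ e n m = πᵗ e (πᵗ n m)

switchᵗ : ∀ {k} → Term k → List (Term k) → Term k
switchᵗ a []       = nat 1
switchᵗ a (t ∷ ts) = condᵗ a t (switchᵗ (predᵗ a) ts)

-- A certificate is a list of facts, each justified by facts further down the
-- list.  fact (♯ c) n m means that c sends n to m, fact (π 9 (♯ c)) n m that c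
-- is positive on π n j for all j < m, and fact (π 10 e) 0 0 that e encodes a
-- program.  An intermediate value (hint) is read off the next fact of the list.
ruleᵗ : Term 8
ruleᵗ = switchᵗ tag
  ( m
  ∷ distᵗ m (succᵗ n)
  ∷ distᵗ m (leftᵗ n)
  ∷ distᵗ m (rightᵗ n)
  ∷ distᵗ m (nat 1 ∸ᵗ memberᵗ n table)
  ∷ known (leftᵗ arg) n (leftᵗ m) +ᵗ known (rightᵗ arg) n (rightᵗ m)
  ∷ known (rightᵗ arg) n hint +ᵗ known (leftᵗ arg) hint m
  ∷ condᵗ (rightᵗ n)
      (known (leftᵗ arg) (leftᵗ n) m)
      (known e (πᵗ (leftᵗ n) (predᵗ (rightᵗ n))) hint +ᵗ
       known (rightᵗ arg) (πᵗ (leftᵗ n) (πᵗ (predᵗ (rightᵗ n)) hint)) m)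
  ∷ known arg (πᵗ n m) (nat 0) +ᵗ known (πᵗ (nat 9) arg) n m
  ∷ condᵗ m (nat 0)
      (known arg (πᵗ n (predᵗ m)) hint +ᵗ (nat 1 ∸ᵗ hint) +ᵗ known (πᵗ (nat 9) arg) n (predᵗ m))
  ∷ switchᵗ (leftᵗ arg)
      ( rightᵗ arg ∷ rightᵗ arg ∷ rightᵗ arg ∷ rightᵗ arg ∷ rightᵗ arg
      ∷ both ∷ both ∷ both ∷ program? (rightᵗ arg) ∷ [])
  ∷ [])
  where
  table tag arg e n m known-facts hint : Term 8
  table       = var (# 0)
  tag         = var (# 1)
  arg         = var (# 2)
  e           = var (# 3)
  n           = var (# 4)
  m           = var (# 5)
  known-facts = var (# 6)
  hint        = var (# 7)

  known : Term 8 → Term 8 → Term 8 → Term 8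
  known a b c = memberᵗ (factᵗ a b c) known-facts

  program? : Term 8 → Term 8
  program? a = known (πᵗ (nat 10) a) (nat 0) (nat 0)

  both : Term 8
  both = program? (leftᵗ (rightᵗ arg)) +ᵗ program? (rightᵗ (rightᵗ arg))

opaque
  apply-rule : Vec ℕ 8 → ℕ
  apply-rule = fn ruleᵗ

  apply-rule≡ : ∀ ρ → fn ruleᵗ ρ ≡ apply-rule ρ
  apply-rule≡ ρ = refl

rule : (table tag arg e n m known hint : ℕ) → ℕ
rule T t a e n m w h = apply-rule (T ∷ t ∷ a ∷ e ∷ n ∷ m ∷ w ∷ h ∷ [])

module _ (T a e n m w h : ℕ) where

  private
    known : ℕ → ℕ → ℕ → ℕ
    known e n m = member (fact e n m) w

    isProgram : ℕ → ℕ
    isProgram a = known (π 10 a) 0 0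

  opaque
    unfolding apply-rule

    rule-zero : rule T 0 a e n m w h ≡ m
    rule-zero = refl

    rule-succ : rule T 1 a e n m w h ≡ ∣ m - suc n ∣
    rule-succ = refl

    rule-left : rule T 2 a e n m w h ≡ ∣ m - left n ∣
    rule-left = refl

    rule-right : rule T 3 a e n m w h ≡ ∣ m - right n ∣
    rule-right = refl

    rule-oracle : rule T 4 a e n m w h ≡ ∣ m - 1 ∸ member n T ∣
    rule-oracle = refl

    rule-pair : rule T 5 a e n m w h ≡ known (left a) n (left m) + known (right a) n (right m)
    rule-pair = refl

    rule-comp : rule T 6 a e n m w h ≡ known (right a) n h + known (left a) h m
    rule-comp = refl

    rule-prec : rule T 7 a e n m w h ≡ cond (right n)
                  (known (left a) (left n) m)
                  (known e (π (left n) (pred (right n))) h +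
                   known (right a) (π (left n) (π (pred (right n)) h)) m)
    rule-prec = refl

    rule-mu : rule T 8 a e n m w h ≡ known a (π n m) 0 + known (π 9 a) n m
    rule-mu = refl

    rule-positive : rule T 9 a e n m w h ≡ cond m 0
                      (known a (π n (pred m)) h + (1 ∸ h) + known (π 9 a) n (pred m))
    rule-positive = refl

    rule-constantProgram : ∀ t → t < 5 → left a ≡ t → rule T 10 a e n m w h ≡ right a
    rule-constantProgram 0 _ eq rewrite eq = refl
    rule-constantProgram 1 _ eq rewrite eq = refl
    rule-constantProgram 2 _ eq rewrite eq = refl
    rule-constantProgram 3 _ eq rewrite eq = refl
    rule-constantProgram 4 _ eq rewrite eq = refl
    rule-constantProgram (suc (suc (suc (suc (suc _))))) (s≤s (s≤s (s≤s (s≤s (s≤s ()))))) _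

    rule-binaryProgram : ∀ t → t < 3 → left a ≡ 5 + t →
                         rule T 10 a e n m w h ≡ isProgram (left (right a)) + isProgram (right (right a))
    rule-binaryProgram 0 _ eq rewrite eq = refl
    rule-binaryProgram 1 _ eq rewrite eq = refl
    rule-binaryProgram 2 _ eq rewrite eq = refl
    rule-binaryProgram (suc (suc (suc _))) (s≤s (s≤s (s≤s ()))) _

    rule-muProgram : left a ≡ 8 → rule T 10 a e n m w h ≡ isProgram (right a)
    rule-muProgram eq rewrite eq = refl

    rule-noProgram : ∀ t → left a ≡ 9 + t → rule T 10 a e n m w h ≡ 1
    rule-noProgram t eq rewrite eq = refl

value : ℕ → ℕ
value F = right (right F)

justify : ℕ → ℕ → ℕ → ℕ
justify T F w =
  rule T (left (left F)) (right (left F)) (left F) (left (right F)) (value F) w (value (head w))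

justifyᵗ : ∀ {k} → Term k → Term k → Term k → Term k
justifyᵗ a b c = retype
  (call (retype ruleᵗ apply-rule apply-rule≡) (a ∷ leftᵗ (leftᵗ b) ∷ rightᵗ (leftᵗ b) ∷ leftᵗ b
    ∷ leftᵗ (rightᵗ b) ∷ valueᵗ b ∷ c ∷ valueᵗ (headᵗ c) ∷ []))
  (λ ρ → justify (fn a ρ) (fn b ρ) (fn c ρ)) (λ ρ → refl)
  where
  valueᵗ : ∀ {k} → Term k → Term k
  valueᵗ a = rightᵗ (rightᵗ a)

invalid : ℕ → ℕ → ℕ
invalid T = walk (λ r → 1 ∸ justify T (head r) (tail r))

invalidᵗ : ∀ {k} → Term k → Term k → Term k
invalidᵗ a b = retype (call (walkᵗ v₁ (nat 1 ∸ᵗ justifyᵗ v₁ (headᵗ v₀) (tailᵗ v₀))) (a ∷ b ∷ []))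
  (λ ρ → invalid (fn a ρ) (fn b ρ)) (λ ρ → refl)

Valid : ℕ → List ℕ → Set
Valid T []      = ⊤
Valid T (F ∷ l) = justify T F (code l) ≡ 0 × Valid T l

valid⁺ : ∀ {T l} → Valid T l → invalid T (code l) ≡ 0
valid⁺ {T} {l} p = walk⁺ _ (go l p)
  where
  go : ∀ l → Valid T l → NoSuffix (λ r → 1 ∸ justify T (head r) (tail r)) l
  go []      _       = tt
  go (F ∷ l) (p , q) = (λ eq → 1+n≢0 (trans (sym lemma) eq)) , go l q
    where
    lemma : 1 ∸ justify T (head (code (F ∷ l))) (tail (code (F ∷ l))) ≡ 1
    lemma = cong (1 ∸_) (trans (cong₂ (justify T) (head-code F l) (tail-code F l)) p)

valid⁻ : ∀ {T} l → invalid T (code l) ≡ 0 → Valid T l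
valid⁻ {T} l p = go l (walk⁻ _ p)
  where
  go : ∀ l → NoSuffix (λ r → 1 ∸ justify T (head r) (tail r)) l → Valid T l
  go []      _       = tt
  go (F ∷ l) (p , q) = lemma (justify T F (code l)) refl , go l q
    where
    lemma : ∀ k → justify T F (code l) ≡ k → justify T F (code l) ≡ 0
    lemma zero    eq = eq
    lemma (suc k) eq = ⊥-elim (p (trans (cong (1 ∸_)
      (trans (cong₂ (justify T) (head-code F l) (tail-code F l)) eq)) (0∸n≡0 k)))

Correct : Pred ℕ 0ℓ → ℕ → ℕ → Set
Correct A T k = ∀ q → q < k → χ A q (1 ∸ member q T)

correct-mono : ∀ {A T j k} → j ≤ k → Correct A T k → Correct A T j
correct-mono j≤k p q q<j = p q (≤-trans q<j j≤k)

record True (A : Pred ℕ 0ℓ) (e n m : ℕ) : Set where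
  field
    runs     : ∀ c → ♯ c ≡ e → Runs A c n m
    positive : ∀ c → π 9 (♯ c) ≡ e → ∀ j → j < m → ∃[ k ] Runs A c (π n j) (suc k)
    encodes  : ∀ a → π 10 a ≡ e → ∃[ c ] ♯ c ≡ a

open True

module Soundness {A : Pred ℕ 0ℓ} {T : ℕ} {l : List ℕ}
  (true : ∀ {e n m} → fact e n m ∈ l → True A e n m) where

  private
    sound : ∀ c {n m} → member (fact (♯ c) n m) (code l) ≡ 0 → Runs A c n m
    sound c p = runs (true (member⁻ l p)) c refl

  rule-runs : ∀ c {n m h} → χ A n (1 ∸ member n T) →
              rule T (left (♯ c)) (right (♯ c)) (♯ c) n m (code l) h ≡ 0 → Runs A c n m
  rule-runs zeroᶜ _ p rewrite ♯-zero | left-π 0 0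
    with refl ← trans (sym (rule-zero T _ _ _ _ _ _)) p = zeroʳ
  rule-runs succᶜ {n} {m} {h} _ p rewrite ♯-succ | left-π 1 0
    with refl ← ∣m-n∣≡0⇒m≡n {m} {suc n} (trans (sym (rule-succ T _ _ n m (code l) h)) p) = succʳ
  rule-runs leftᶜ {n} {m} {h} _ p rewrite ♯-left | left-π 2 0
    with refl ← ∣m-n∣≡0⇒m≡n {m} {left n} (trans (sym (rule-left T _ _ n m (code l) h)) p) = leftʳ
  rule-runs rightᶜ {n} {m} {h} _ p rewrite ♯-right | left-π 3 0
    with refl ← ∣m-n∣≡0⇒m≡n {m} {right n} (trans (sym (rule-right T _ _ n m (code l) h)) p) = rightʳ
  rule-runs oracleᶜ {n} {m} {h} χn p rewrite ♯-oracle | left-π 4 0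
    with refl ← ∣m-n∣≡0⇒m≡n {m} {1 ∸ member n T} (trans (sym (rule-oracle T _ _ n m (code l) h)) p) = oracleʳ χn
  rule-runs (pairᶜ c d) {n} {m} {h} _ p
    rewrite ♯-pair c d | left-π 5 (π (♯ c) (♯ d)) | right-π 5 (π (♯ c) (♯ d))
          | rule-pair T (π (♯ c) (♯ d)) (π 5 (π (♯ c) (♯ d))) n m (code l) h
          | left-π (♯ c) (♯ d) | right-π (♯ c) (♯ d) =
    subst (Runs A (pairᶜ c d) n) (π-left-right m)
      (pairʳ (sound c (m+n≡0⇒m≡0 _ p)) (sound d (m+n≡0⇒n≡0 (member (fact (♯ c) n (left m)) (code l)) p)))
  rule-runs (compᶜ c d) {n} {m} {h} _ p
    rewrite ♯-comp c d | left-π 6 (π (♯ c) (♯ d)) | right-π 6 (π (♯ c) (♯ d))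
          | rule-comp T (π (♯ c) (♯ d)) (π 6 (π (♯ c) (♯ d))) n m (code l) h
          | left-π (♯ c) (♯ d) | right-π (♯ c) (♯ d) =
    compʳ (sound d (m+n≡0⇒m≡0 _ p)) (sound c (m+n≡0⇒n≡0 (member (fact (♯ d) n h) (code l)) p))
  rule-runs (precᶜ c d) {n} {m} {h} _ p
    rewrite ♯-prec c d | left-π 7 (π (♯ c) (♯ d)) | right-π 7 (π (♯ c) (♯ d))
          | rule-prec T (π (♯ c) (♯ d)) (π 7 (π (♯ c) (♯ d))) n m (code l) h
          | left-π (♯ c) (♯ d) | right-π (♯ c) (♯ d) with right n in eq
  ... | zero  = prec₀ʳ eq (sound c p)
  ... | suc i = precₛʳ eq
    (sound (precᶜ c d) (subst (λ e → member (fact e (π (left n) i) h) (code l) ≡ 0)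
                          (sym (♯-prec c d)) (m+n≡0⇒m≡0 _ p)))
    (sound d (m+n≡0⇒n≡0 (member (fact (π 7 (π (♯ c) (♯ d))) (π (left n) i) h) (code l)) p))
  rule-runs (muᶜ c) {n} {m} {h} _ p
    rewrite ♯-mu c | left-π 8 (♯ c) | right-π 8 (♯ c)
          | rule-mu T (♯ c) (π 8 (♯ c)) n m (code l) h =
    muʳ (sound c (m+n≡0⇒m≡0 _ p))
        (positive (true (member⁻ l (m+n≡0⇒n≡0 (member (fact (♯ c) (π n m) 0) (code l)) p))) c refl)

  rule-runsPositive : ∀ c {n m h} → rule T 9 (♯ c) (π 9 (♯ c)) n m (code l) h ≡ 0 →
                      ∀ j → j < m → ∃[ k ] Runs A c (π n j) (suc k)
  rule-runsPositive c {n} {suc i} {h} p j j<m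
    rewrite rule-positive T (♯ c) (π 9 (♯ c)) n (suc i) (code l) h with m≤n⇒m<n∨m≡n (s≤s⁻¹ j<m)
  ... | inj₁ j<i = positive (true (member⁻ l
    (m+n≡0⇒n≡0 (member (fact (♯ c) (π n i) h) (code l) + (1 ∸ h)) p))) c refl j j<i
  ... | inj₂ refl with h
  ...   | suc k = k , sound c (m+n≡0⇒m≡0 _ (m+n≡0⇒m≡0 _ p))
  ...   | zero with () ← m+n≡0⇒n≡0 (member (fact (♯ c) (π n i) 0) (code l)) (m+n≡0⇒m≡0 _ p)

  rule-encodes : ∀ a {e n m h} → rule T 10 a e n m (code l) h ≡ 0 → ∃[ c ] ♯ c ≡ a
  rule-encodes a p = go (left a) refl
    where
    isProgram : ∀ b → member (fact (π 10 b) 0 0) (code l) ≡ 0 → ∃[ c ] ♯ c ≡ b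
    isProgram b q = encodes (true (member⁻ l q)) b refl

    constant : ∀ c k → k < 5 → ♯ c ≡ π k 0 → left a ≡ k → ∃[ c ] ♯ c ≡ a
    constant c k k<5 eq eql = c , trans eq (trans (cong₂ π (sym eql)
      (trans (sym p) (rule-constantProgram T a _ _ _ _ _ k k<5 eql))) (π-left-right a))

    binary : ∀ (_⊕_ : Code → Code → Code) k → k < 3 → (∀ c d → ♯ (c ⊕ d) ≡ π (5 + k) (π (♯ c) (♯ d))) →
             left a ≡ 5 + k → ∃[ c ] ♯ c ≡ a
    binary _⊕_ k k<3 ♯-⊕ eql
      with q ← trans (sym (rule-binaryProgram T a _ _ _ _ _ k k<3 eql)) p
      with c , c≡ ← isProgram (left (right a)) (m+n≡0⇒m≡0 _ q)
         | d , d≡ ← isProgram (right (right a))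
             (m+n≡0⇒n≡0 (member (fact (π 10 (left (right a))) 0 0) (code l)) q) =
      c ⊕ d , trans (♯-⊕ c d) (trans (cong₂ π (sym eql)
        (trans (cong₂ π c≡ d≡) (π-left-right (right a)))) (π-left-right a))

    go : ∀ t → left a ≡ t → ∃[ c ] ♯ c ≡ a
    go 0 eq = constant zeroᶜ 0 (s≤s z≤n) ♯-zero eq
    go 1 eq = constant succᶜ 1 (s≤s (s≤s z≤n)) ♯-succ eq
    go 2 eq = constant leftᶜ 2 (s≤s (s≤s (s≤s z≤n))) ♯-left eq
    go 3 eq = constant rightᶜ 3 (s≤s (s≤s (s≤s (s≤s z≤n)))) ♯-right eq
    go 4 eq = constant oracleᶜ 4 ≤-refl ♯-oracle eq
    go 5 eq = binary pairᶜ 0 (s≤s z≤n) ♯-pair eq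
    go 6 eq = binary compᶜ 1 (s≤s (s≤s z≤n)) ♯-comp eq
    go 7 eq = binary precᶜ 2 ≤-refl ♯-prec eq
    go 8 eq with c , c≡ ← isProgram (right a) (trans (sym (rule-muProgram T a _ _ _ _ _ eq)) p) =
      muᶜ c , trans (♯-mu c) (trans (cong₂ π (sym eq) c≡) (π-left-right a))
    go (suc (suc (suc (suc (suc (suc (suc (suc (suc t))))))))) eq
      with () ← trans (sym p) (rule-noProgram T a _ _ _ _ _ t eq)

justify-fact : ∀ T e n m w → justify T (fact e n m) w ≡ rule T (left e) (right e) e n m w (value (head w))
justify-fact T e n m w
  rewrite left-π e (π n m) | right-π e (π n m) | left-π n m | right-π n m = refl

soundness : ∀ {A T} l → Correct A T (code l) → Valid T l → ∀ {e n m} → fact e n m ∈ l → True A e n m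
soundness (F ∷ l) correct (_ , valid) (there F∈) =
  soundness l (correct-mono (<⇒≤ (tail<code F l)) correct) valid F∈
soundness {A} {T} (_ ∷ l) correct (justified , valid) {e} {n} {m} (here refl) = record
  { runs     = λ { c refl → rule-runs c (correct n n<) eq }
  ; positive = λ { c refl → rule-runsPositive c (subst₂
      (λ t a → rule T t a (π 9 (♯ c)) n m (code l) (value (head (code l))) ≡ 0)
      (left-π 9 (♯ c)) (right-π 9 (♯ c)) eq) }
  ; encodes  = λ { a refl → rule-encodes a (subst₂
      (λ t b → rule T t b (π 10 a) n m (code l) (value (head (code l))) ≡ 0)
      (left-π 10 a) (right-π 10 a) eq) }
  }
  where
  open Soundness {A} {T} {l}
    (soundness l (correct-mono (<⇒≤ (tail<code (fact e n m) l)) correct) valid)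

  eq : rule T (left e) (right e) e n m (code l) (value (head (code l))) ≡ 0
  eq = trans (sym (justify-fact T e n m (code l))) justified

  n< : n < code (fact e n m ∷ l)
  n< = ≤-trans (s≤s (≤-trans (x≤π n m) (y≤π e (π n m)))) (head<code (fact e n m) l)

Acceptable : Pred ℕ 0ℓ → List ℕ → Set
Acceptable A l = ∃[ k ] (∀ {T} → Correct A T k → Valid T l)

Extends : Pred ℕ 0ℓ → List ℕ → ℕ → Set
Extends A l F = ∃[ l′ ] Acceptable A (F ∷ l′) × l ⊆ F ∷ l′

acceptable-nil : ∀ {A} → Acceptable A []
acceptable-nil = 0 , λ _ → tt

extend : ∀ {A l l′} e n m → Acceptable A l′ → l ⊆ l′ →
         (∃[ k ] (∀ {T} → Correct A T k →
           rule T (left e) (right e) e n m (code l′) (value (head (code l′))) ≡ 0)) →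
         Extends A l (fact e n m)
extend {l′ = l′} e n m (j , valid) l⊆ (k , justified) =
  l′ , (j ⊔ k , λ {T} correct →
    trans (justify-fact T e n m (code l′)) (justified (correct-mono (m≤n⊔m j k) correct)) ,
    valid (correct-mono (m≤m⊔n j k) correct)) , λ x∈ → there (l⊆ x∈)

hint : ∀ e n m l → value (head (code (fact e n m ∷ l))) ≡ m
hint e n m l rewrite head-code (fact e n m) l | right-π e (π n m) = right-π n m

both : ∀ {x y l} → x ∈ l → y ∈ l → member x (code l) + member y (code l) ≡ 0
both x∈ y∈ = cong₂ _+_ (member⁺ x∈) (member⁺ y∈)

completeness-program : ∀ {A l} c → Acceptable A l → Extends A l (fact (π 10 (♯ c)) 0 0)
completeness-program {A} c acc = go c acc
  where
  goal : ∀ {l l′} a → Acceptable A l′ → l ⊆ l′ →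
         (∀ {T h} → rule T 10 a (π 10 a) 0 0 (code l′) h ≡ 0) → Extends A l (fact (π 10 a) 0 0)
  goal {l′ = l′} a acc l⊆ p = extend _ _ _ acc l⊆ (0 , λ {T} _ →
    subst₂ (λ t b → rule T t b (π 10 a) 0 0 (code l′) (value (head (code l′))) ≡ 0)
      (sym (left-π 10 a)) (sym (right-π 10 a)) p)

  constant : ∀ {l} k → k < 5 → Acceptable A l → Extends A l (fact (π 10 (π k 0)) 0 0)
  constant k k<5 acc = goal (π k 0) acc (λ x∈ → x∈)
    (trans (rule-constantProgram _ _ _ _ _ _ _ k k<5 (left-π k 0)) (right-π k 0))

  binary : ∀ {l a b} k → k < 3 → (∀ {l} → Acceptable A l → Extends A l (fact (π 10 a) 0 0)) →
           (∀ {l} → Acceptable A l → Extends A l (fact (π 10 b) 0 0)) →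
           Acceptable A l → Extends A l (fact (π 10 (π (5 + k) (π a b))) 0 0)
  binary {a = a} {b} k k<3 p q acc
    with l₁ , acc₁ , l⊆ ← p acc
    with l₂ , acc₂ , l₁⊆ ← q acc₁ = goal _ acc₂ (λ x∈ → l₁⊆ (l⊆ x∈)) λ {T} {h} →
      trans (rule-binaryProgram T _ _ _ _ _ h k k<3 (left-π (5 + k) _))
        (lemma (both (l₁⊆ (here refl)) (here refl)))
    where
    lemma : ∀ {w} → member (fact (π 10 a) 0 0) w + member (fact (π 10 b) 0 0) w ≡ 0 →
            member (fact (π 10 (left (right (π (5 + k) (π a b))))) 0 0) w +
            member (fact (π 10 (right (right (π (5 + k) (π a b))))) 0 0) w ≡ 0
    lemma eq rewrite right-π (5 + k) (π a b) | left-π a b | right-π a b = eq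

  go : ∀ {l} c → Acceptable A l → Extends A l (fact (π 10 (♯ c)) 0 0)
  go zeroᶜ   acc rewrite ♯-zero   = constant 0 (s≤s z≤n) acc
  go succᶜ   acc rewrite ♯-succ   = constant 1 (s≤s (s≤s z≤n)) acc
  go leftᶜ   acc rewrite ♯-left   = constant 2 (s≤s (s≤s (s≤s z≤n))) acc
  go rightᶜ  acc rewrite ♯-right  = constant 3 (s≤s (s≤s (s≤s (s≤s z≤n)))) acc
  go oracleᶜ acc rewrite ♯-oracle = constant 4 ≤-refl acc
  go (pairᶜ c d) acc rewrite ♯-pair c d = binary 0 (s≤s z≤n) (go c) (go d) acc
  go (compᶜ c d) acc rewrite ♯-comp c d = binary 1 (s≤s (s≤s z≤n)) (go c) (go d) acc
  go (precᶜ c d) acc rewrite ♯-prec c d = binary 2 ≤-refl (go c) (go d) acc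
  go (muᶜ c) acc rewrite ♯-mu c with l₁ , acc₁ , l⊆ ← go c acc = goal _ acc₁ l⊆ λ {T} {h} →
    trans (rule-muProgram T _ _ _ _ _ h (left-π 8 (♯ c)))
      (subst (λ a → member (fact (π 10 a) 0 0) (code (fact (π 10 (♯ c)) 0 0 ∷ l₁)) ≡ 0)
        (sym (right-π 8 (♯ c))) (member⁺ (here refl)))

χ-deterministic : ∀ {A n m m′} → χ A n m → χ A n m′ → m ≡ m′
χ-deterministic {A} {n} p q = runs-deterministic {A} {oracleᶜ} {n} (oracleʳ p) (oracleʳ q)

extend-tagged : ∀ {A l l′} e k a n m → e ≡ π k a → Acceptable A l′ → l ⊆ l′ →
                (∃[ j ] (∀ {T} → Correct A T j → rule T k a e n m (code l′) (value (head (code l′))) ≡ 0)) →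
                Extends A l (fact e n m)
extend-tagged {l′ = l′} e k a n m refl acc l⊆ (j , p) = extend e n m acc l⊆ (j , λ {T} correct →
  subst₂ (λ t b → rule T t b e n m (code l′) (value (head (code l′))) ≡ 0)
    (sym (left-π k a)) (sym (right-π k a)) (p correct))

completeness : ∀ {A c n m l} → Runs A c n m → Acceptable A l → Extends A l (fact (♯ c) n m)
completeness-positive : ∀ {A c n m l} → (∀ i → i < m → ∃[ k ] Runs A c (π n i) (suc k)) →
                        ∀ i → i ≤ m → Acceptable A l → Extends A l (fact (π 9 (♯ c)) n i)

completeness zeroʳ acc = extend-tagged _ 0 0 _ _ ♯-zero acc (λ x∈ → x∈)
  (0 , λ _ → rule-zero _ _ _ _ _ _ _)
completeness {n = n} succʳ acc = extend-tagged _ 1 0 _ _ ♯-succ acc (λ x∈ → x∈)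
  (0 , λ _ → trans (rule-succ _ _ _ n _ _ _) (∣n-n∣≡0 (suc n)))
completeness {n = n} leftʳ acc = extend-tagged _ 2 0 _ _ ♯-left acc (λ x∈ → x∈)
  (0 , λ _ → trans (rule-left _ _ _ n _ _ _) (∣n-n∣≡0 (left n)))
completeness {n = n} rightʳ acc = extend-tagged _ 3 0 _ _ ♯-right acc (λ x∈ → x∈)
  (0 , λ _ → trans (rule-right _ _ _ n _ _ _) (∣n-n∣≡0 (right n)))
completeness {A} {n = n} (oracleʳ p) acc = extend-tagged _ 4 0 _ _ ♯-oracle acc (λ x∈ → x∈)
  (suc n , λ correct → trans (rule-oracle _ _ _ n _ _ _)
    (m≡n⇒∣m-n∣≡0 (χ-deterministic {A} {n} p (correct n ≤-refl))))
completeness {A} {n = n} (pairʳ {c} {d} {x = x} {y} p q) acc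
  with l₁ , acc₁ , l⊆ ← completeness p acc
  with l₂ , acc₂ , l₁⊆ ← completeness q acc₁ =
  extend-tagged _ 5 (π (♯ c) (♯ d)) _ _ (♯-pair c d) acc₂ (λ x∈ → l₁⊆ (l⊆ x∈)) (0 , λ _ →
    trans (rule-pair _ _ _ n _ _ _) (lemma (both (l₁⊆ (here refl)) (here refl))))
  where
  lemma : ∀ {w} → member (fact (♯ c) n x) w + member (fact (♯ d) n y) w ≡ 0 →
          member (fact (left (π (♯ c) (♯ d))) n (left (π x y))) w +
          member (fact (right (π (♯ c) (♯ d))) n (right (π x y))) w ≡ 0
  lemma eq rewrite left-π (♯ c) (♯ d) | right-π (♯ c) (♯ d) | left-π x y | right-π x y = eq
completeness {A} {n = n} {m} (compʳ {c} {d} {k = k} p q) acc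
  with l₁ , acc₁ , l⊆ ← completeness q acc
  with l₂ , acc₂ , l₁⊆ ← completeness p acc₁ =
  extend-tagged _ 6 (π (♯ c) (♯ d)) _ _ (♯-comp c d) acc₂ (λ x∈ → l₁⊆ (l⊆ x∈)) (0 , λ _ →
    trans (rule-comp _ _ _ n _ _ _) (lemma (hint (♯ d) n k l₂) (both (here refl) (l₁⊆ (here refl)))))
  where
  lemma : ∀ {w h} → h ≡ k → member (fact (♯ d) n k) w + member (fact (♯ c) k m) w ≡ 0 →
          member (fact (right (π (♯ c) (♯ d))) n h) w + member (fact (left (π (♯ c) (♯ d))) h m) w ≡ 0
  lemma refl eq rewrite left-π (♯ c) (♯ d) | right-π (♯ c) (♯ d) = eq
completeness {A} {n = n} {m} (prec₀ʳ {c} {d} eq p) acc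
  with l₁ , acc₁ , l⊆ ← completeness p acc =
  extend-tagged _ 7 (π (♯ c) (♯ d)) _ _ (♯-prec c d) acc₁ l⊆ (0 , λ _ →
    trans (rule-prec _ _ _ n _ _ _) (lemma (member⁺ (here refl))))
  where
  lemma : ∀ {w k} → member (fact (♯ c) (left n) m) w ≡ 0 →
          cond (right n) (member (fact (left (π (♯ c) (♯ d))) (left n) m) w) k ≡ 0
  lemma p rewrite eq | left-π (♯ c) (♯ d) = p
completeness {A} {n = n} {m} (precₛʳ {c} {d} {i = i} {r} eq p q) acc
  with l₁ , acc₁ , l⊆ ← completeness q acc
  with l₂ , acc₂ , l₁⊆ ← completeness p acc₁ =
  extend-tagged _ 7 (π (♯ c) (♯ d)) _ _ (♯-prec c d) acc₂ (λ x∈ → l₁⊆ (l⊆ x∈)) (0 , λ _ →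
    trans (rule-prec _ _ _ n _ _ _) (lemma (hint _ _ r l₂) (both (here refl) (l₁⊆ (here refl)))))
  where
  e = ♯ (precᶜ c d)
  lemma : ∀ {w h k} → h ≡ r →
          member (fact e (π (left n) i) r) w + member (fact (♯ d) (π (left n) (π i r)) m) w ≡ 0 →
          cond (right n) k
            (member (fact e (π (left n) (pred (right n))) h) w +
             member (fact (right (π (♯ c) (♯ d))) (π (left n) (π (pred (right n)) h)) m) w) ≡ 0
  lemma refl p rewrite eq | right-π (♯ c) (♯ d) = p
completeness {A} {n = n} {m} (muʳ {c} p q) acc
  with l₁ , acc₁ , l⊆ ← completeness p acc
  with l₂ , acc₂ , l₁⊆ ← completeness-positive q m ≤-refl acc₁ =
  extend-tagged _ 8 (♯ c) _ _ (♯-mu c) acc₂ (λ x∈ → l₁⊆ (l⊆ x∈)) (0 , λ _ →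
    trans (rule-mu _ _ _ n _ _ _) (both (l₁⊆ (here refl)) (here refl)))

completeness-positive {c = c} {n} q zero _ acc =
  extend-tagged _ 9 (♯ c) _ _ refl acc (λ x∈ → x∈) (0 , λ _ → rule-positive _ _ _ n 0 _ _)
completeness-positive {c = c} {n} q (suc i) i<m acc
  with l₁ , acc₁ , l⊆ ← completeness-positive q i (<⇒≤ i<m) acc
  with l₂ , acc₂ , l₁⊆ ← completeness (proj₂ (q i i<m)) acc₁ =
  extend-tagged _ 9 (♯ c) _ _ refl acc₂ (λ x∈ → l₁⊆ (l⊆ x∈)) (0 , λ _ →
    trans (rule-positive _ _ _ n (suc i) _ _)
      (lemma (hint _ _ (suc k) l₂) (both (here refl) (l₁⊆ (here refl)))))
  where
  k = proj₁ (q i i<m)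
  lemma : ∀ {w h} → h ≡ suc k → member (fact (♯ c) (π n i) (suc k)) w + member (fact (π 9 (♯ c)) n i) w ≡ 0 →
          member (fact (♯ c) (π n i) h) w + (1 ∸ h) + member (fact (π 9 (♯ c)) n i) w ≡ 0
  lemma {w} refl eq rewrite 0∸n≡0 k | +-identityʳ (member (fact (♯ c) (π n i) (suc k)) w) = eq

-- Tables for jumps and limits

rejects : ℕ → ℕ → ℕ → ℕ → ℕ
rejects T e n w = member (fact e n (value (head w))) w + invalid T w

rejectsᵗ : ∀ {k} → Term k → Term k → Term k → Term k → Term k
rejectsᵗ T e n w = memberᵗ (factᵗ e n (rightᵗ (rightᵗ (headᵗ w)))) w +ᵗ invalidᵗ T w

rejects-sound : ∀ {A T w} c n → Correct A T w → rejects T (♯ c) n w ≡ 0 → Runs A c n (value (head w))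
rejects-sound {T = T} {w} c n correct p with code-surjective w
... | l , refl = runs (soundness l correct (valid⁻ l (m+n≡0⇒n≡0 (member (fact (♯ c) n (value (head w))) w) p))
                  (member⁻ l (m+n≡0⇒m≡0 _ p))) c refl

certificate : ∀ {T e n m l} → Valid T (fact e n m ∷ l) → rejects T e n (code (fact e n m ∷ l)) ≡ 0
certificate {e = e} {n} {m} {l} valid = cong₂ _+_
  (subst (λ h → member (fact e n h) (code (fact e n m ∷ l)) ≡ 0) (sym (hint e n m l)) (member⁺ (here refl)))
  (valid⁺ {l = fact e n m ∷ l} valid)

jumpRejects : ℕ → ℕ → ℕ → ℕ
jumpRejects T e w = rejects T e e w + member (fact (π 10 e) 0 0) w

jumpTable : ℕ → ℕ → ℕ
jumpTable n T = code (select (λ e → jumpRejects T e (search (jumpRejects T e) n)) n)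

jumpTableᵗ : ∀ {k} → Term k → Term k → Term k
jumpTableᵗ a b = retype (call (selectᵗ v₀ (foundᵗ v₁
    (rejectsᵗ (var (# 3)) v₁ v₁ v₀ +ᵗ memberᵗ (factᵗ (πᵗ (nat 10) v₁) (nat 0) (nat 0)) v₀))) (a ∷ b ∷ []))
  (λ ρ → jumpTable (fn a ρ) (fn b ρ)) (λ ρ → refl)

jump⇒certificate : ∀ {A e} → jump A e → ∃[ w ] ∃[ k ] (∀ {T} → Correct A T k → jumpRejects T e w ≡ 0)
jump⇒certificate {e = e} (m , c , refl , ev)
  with l₁ , acc₁ , _ ← completeness-program c acceptable-nil
  with l₂ , (k , valid) , l₁⊆ ← completeness (eval⇒runs c ev) acc₁
  rewrite sym (♯≡encode c) =
  code (fact (♯ c) (♯ c) m ∷ l₂) , k , λ correct →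
    cong₂ _+_ (certificate (valid correct)) (member⁺ (l₁⊆ (here refl)))

certificate⇒jump : ∀ {A T w} e → Correct A T w → jumpRejects T e w ≡ 0 → jump A e
certificate⇒jump {T = T} {w} e correct p
  with l , refl ← code-surjective w
  with c , refl ← encodes
    (soundness l correct (valid⁻ l (m+n≡0⇒n≡0 (member (fact e e (value (head w))) w) (m+n≡0⇒m≡0 _ p)))
                    (member⁻ l (m+n≡0⇒n≡0 (rejects T e e w) p))) e refl =
  _ , c , sym (♯≡encode c) , runs⇒eval (rejects-sound c _ correct (m+n≡0⇒m≡0 _ p))

bit-∈ : ∀ {A q l} → A q → q ∈ l → χ A q (1 ∸ member q (code l))
bit-∈ Aq q∈ = inj₁ (Aq , cong (1 ∸_) (member⁺ q∈))

bit-∉ : ∀ {A q l} → ¬ A q → ¬ q ∈ l → χ A q (1 ∸ member q (code l))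
bit-∉ ¬Aq q∉ = inj₂ (¬Aq , cong (1 ∸_) (member-∉ q∉))

jumpTable-correct : ∀ {A T k n} → k ≤ n → Correct A T n →
  (∀ e → e < k → (∃[ w ] w ≤ n × jumpRejects T e w ≡ 0) ⊎ ¬ jump A e) → Correct (jump A) (jumpTable n T) k
jumpTable-correct {A} {T} {k} {n} k≤n correct decided e e<k with decided e e<k
... | inj₁ (w , w≤n , p) = bit-∈ {jump A}
  (certificate⇒jump e (correct-mono w≤n correct) p)
  (∈-select⁺ _ (≤-trans e<k k≤n) (search-finds (jumpRejects T e) n p w≤n))
... | inj₂ ¬jump = bit-∉ {jump A} ¬jump λ e∈ → ¬jump (certificate⇒jump e
  (correct-mono (search≤bound (jumpRejects T e) n) correct) (∈-select⁻ _ n e∈))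

nth : ℕ → ℕ → ℕ
nth i w = head (loop w (λ _ → tail) i)

limTable : ℕ → ℕ → ℕ
limTable n w = code (select (λ q → member (left q) (nth (right q) w)) n)

limTableᵗ : ∀ {k} → Term k → Term k → Term k
limTableᵗ a b = retype (call (selectᵗ v₀ (memberᵗ (leftᵗ v₀)
    (headᵗ (loopᵗ (rightᵗ v₀) (var (# 2)) (tailᵗ v₁))))) (a ∷ b ∷ []))
  (λ ρ → limTable (fn a ρ) (fn b ρ)) (λ ρ → refl)

bit : ∀ x w → (member x w ≡ 0) ⊎ (member x w ≡ 1)
bit x w with l , refl ← code-surjective w with x ∈? l
... | yes x∈ = inj₁ (member⁺ x∈)
... | no  x∉ = inj₂ (member-∉ x∉)

limTable-correct : ∀ {A : ℕ → Pred ℕ 0ℓ} {w k n} → k ≤ n → (∀ i → i ≤ n → Correct (A i) (nth i w) k) →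
                   Correct (λ q → A (right q) (left q)) (limTable n w) k
limTable-correct {A} {w} {k} {n} k≤n correct q q<k
  with bit (left q) (nth (right q) w)
     | correct (right q) (≤-trans (right≤ q) (≤-trans (<⇒≤ q<k) k≤n)) (left q) (≤-trans (s≤s (left≤ q)) q<k)
... | inj₁ eq | inj₁ (Aq , _) = bit-∈ {λ q → A (right q) (left q)} Aq (∈-select⁺ _ (≤-trans q<k k≤n) eq)
... | inj₁ eq | inj₂ (_ , eq′) with () ← trans (sym eq′) (cong (1 ∸_) eq)
... | inj₂ eq | inj₂ (¬Aq , _) = bit-∉ {λ q → A (right q) (left q)} ¬Aq λ q∈ →
  1+n≢0 (trans (sym eq) (∈-select⁻ _ n q∈))
... | inj₂ eq | inj₁ (_ , eq′) with () ← trans (sym eq′) (cong (1 ∸_) eq)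

correct-nil : ∀ k → Correct ∅ 0 k
correct-nil k q _ = bit-∉ {∅} {q} {[]} (λ ()) (λ ())

universalᶜ : Code
universalᶜ = letᶜ (muᶜ (compᶜ (program test) (pairᶜ rightᶜ leftᶜ))) (program output)
  where
  test output : Term 3
  test   = rejectsᵗ (nat 0) v₁ (var (# 2)) v₀
  output = rightᵗ (rightᵗ (headᵗ v₀))

runs-universal : ∀ {e n m} → φ e n m → Runs ∅ universalᶜ (env (e ∷ n ∷ [])) m
runs-universal {n = n} {m} (c , refl , ev)
  with l , (_ , valid) , _ ← completeness (eval⇒runs c ev) acceptable-nil
  rewrite sym (♯≡encode c) =
  subst (Runs ∅ universalᶜ (env ρ))
    (runs-deterministic (rejects-sound c n (correct-nil w) found) (eval⇒runs c ev))
    (runs-let (muʳ (test found) below) (correct (rightᵗ (rightᵗ (headᵗ v₀))) (w ∷ ρ)))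
  where
  ρ : Vec ℕ 2
  ρ = ♯ c ∷ n ∷ []

  h : ℕ → ℕ
  h = rejects 0 (♯ c) n

  w₀ w : ℕ
  w₀ = code (fact (♯ c) n m ∷ l)
  w = search h w₀

  found : h w ≡ 0
  found = search-finds h w₀ (certificate (valid (correct-nil _))) ≤-refl

  test : ∀ {w k} → h w ≡ k →
         Runs ∅ (compᶜ (program (rejectsᵗ {3} (nat 0) v₁ (var (# 2)) v₀)) (pairᶜ rightᶜ leftᶜ)) (π (env ρ) w) k
  test {w} refl = compʳ (pairʳ runs-right runs-left) (correct (rejectsᵗ {3} (nat 0) v₁ (var (# 2)) v₀) (w ∷ ρ))

  below : ∀ i → i < w → ∃[ k ] Runs ∅ _ (π (env ρ) i) (suc k)
  below i i<w with h i in eq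
  ... | zero  = ⊥-elim (search-below h w₀ i i<w eq)
  ... | suc k = k , test eq

-- Parsing members of the barriers

exponent : (ℕ → ℕ) → ℕ → ℕ
exponent f a = search (λ r → ∣ f r - a ∣) a

exponent-hit : ∀ (f : ℕ → ℕ) b → b ≤ f b → (∀ {x y} → f x ≡ f y → x ≡ y) → exponent f (f b) ≡ b
exponent-hit f b b≤ inj =
  inj (∣m-n∣≡0⇒m≡n (search-finds (λ r → ∣ f r - f b ∣) (f b) (∣n-n∣≡0 (f b)) b≤))

n≤m^n : ∀ {m} → 1 < m → ∀ n → n ≤ m ^ n
n≤m^n         1<m zero    = z≤n
n≤m^n {m = m} 1<m (suc n) = ≤-trans (s≤s (n≤m^n 1<m n)) (^-monoʳ-< m 1<m {n} {suc n} ≤-refl)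

^-injectiveʳ : ∀ {m} → 1 < m → ∀ {x y} → m ^ x ≡ m ^ y → x ≡ y
^-injectiveʳ {m} 1<m {x} {y} eq with <-cmp x y
... | tri< x<y _ _ = ⊥-elim (<-irrefl eq (^-monoʳ-< m 1<m x<y))
... | tri≈ _ x≡y _ = x≡y
... | tri> _ _ x>y = ⊥-elim (<-irrefl (sym eq) (^-monoʳ-< m 1<m x>y))

1<2 : 1 < 2
1<2 = s≤s (s≤s z≤n)

1<5 : 1 < 5
1<5 = s≤s (s≤s z≤n)

5^z-odd : ∀ z → 5 ^ z % 2 ≡ 1
5^z-odd zero    = refl
5^z-odd (suc z) = trans (%-distribˡ-* 5 (5 ^ z) 2) (cong (λ r → 1 * r % 2) (5^z-odd z))

2^x≢3*5^z : ∀ x z → 2 ^ x ≢ 3 * 5 ^ z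
2^x≢3*5^z zero    z eq with 5 ^ z | 5^z-odd z
... | suc k | _ = m+1+n≢0 k (sym (suc-injective eq))
2^x≢3*5^z (suc x) z eq with () ← trans (sym (trans (cong (_% 2) (*-comm 2 (2 ^ x))) (m*n%n≡0 (2 ^ x) 2)))
  (trans (cong (_% 2) eq) (trans (%-distribˡ-* 3 (5 ^ z) 2) (cong (λ r → 1 * r % 2) (5^z-odd z))))

3*5^-injective : ∀ {x y} → 3 * 5 ^ x ≡ 3 * 5 ^ y → x ≡ y
3*5^-injective {x} {y} eq = ^-injectiveʳ 1<5 (*-cancelˡ-≡ (5 ^ x) (5 ^ y) 3 eq)

≢⇒dist : ∀ {m n} → m ≢ n → ∃[ k ] ∣ m - n ∣ ≡ suc k
≢⇒dist {m} {n} m≢n with ∣ m - n ∣ in eq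
... | zero  = ⊥-elim (m≢n (∣m-n∣≡0⇒m≡n eq))
... | suc k = k , refl

log₂ logₗ isOne isSucc : ℕ → ℕ
log₂ = exponent (2 ^_)
logₗ = exponent (λ z → 3 * 5 ^ z)
isOne a  = ∣ a - 1 ∣
isSucc a = ∣ 2 ^ log₂ a - a ∣

log₂ᵗ logₗᵗ isOneᵗ isSuccᵗ : ∀ {k} → Term k → Term k
log₂ᵗ a   = searchᵗ a (distᵗ (nat 2 ^ᵗ v₀) (wk₀ a))
logₗᵗ a   = searchᵗ a (distᵗ (nat 3 *ᵗ (nat 5 ^ᵗ v₀)) (wk₀ a))
isOneᵗ a  = distᵗ a (nat 1)
isSuccᵗ a = distᵗ (nat 2 ^ᵗ log₂ᵗ a) a

module Classification where

  succ-notOne : ∀ {b} → 0 < b → ∃[ k ] isOne (2 ^ b) ≡ suc k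
  succ-notOne {b} 0<b = ≢⇒dist λ eq → <-irrefl (sym (^-injectiveʳ 1<2 {b} {0} eq)) 0<b

  log₂-succ : ∀ b → log₂ (2 ^ b) ≡ b
  log₂-succ b = exponent-hit (2 ^_) b (n≤m^n 1<2 b) (^-injectiveʳ 1<2)

  isSucc-succ : ∀ b → isSucc (2 ^ b) ≡ 0
  isSucc-succ b = m≡n⇒∣m-n∣≡0 (cong (2 ^_) (log₂-succ b))

  lim-notOne : ∀ z → ∃[ k ] isOne (3 * 5 ^ z) ≡ suc k
  lim-notOne z = ≢⇒dist λ eq → 2^x≢3*5^z 0 z (sym eq)

  logₗ-lim : ∀ z → logₗ (3 * 5 ^ z) ≡ z
  logₗ-lim z = exponent-hit _ z (≤-trans (n≤m^n 1<5 z) (m≤m+n _ _)) 3*5^-injective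

  lim-notSucc : ∀ z → ∃[ k ] isSucc (3 * 5 ^ z) ≡ suc k
  lim-notSucc z = ≢⇒dist (2^x≢3*5^z (log₂ (3 * 5 ^ z)) z)

-- parseᶜ sends the notation a and a coded list s ++ r with s in B_a to the
-- table of s and the coded rest r.  Its first argument is its own code, which
-- takes the place of the recursion theorem.
module Parse where

  d a s : Term 3
  d = v₀
  a = v₁
  s = var (# 2)

  -- A successor takes one round, a limit 3·5^z with first number n takes n + 1
  -- rounds, for φ_z(n), …, φ_z(0).  Running index on input yields the notation to
  -- be parsed in round j (index is the identity program for a successor).
  count init : Term 3
  count = condᵗ (isOneᵗ a) (nat 0) (condᵗ (isSuccᵗ a) (nat 1) (succᵗ (headᵗ s)))
  init  = πᵗ (nat 0) (condᵗ (isOneᵗ a) s (tailᵗ s))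

  index input : Term 5
  index = condᵗ (isSuccᵗ (wk₀ (wk₀ a))) (nat (♯ idᶜ)) (logₗᵗ (wk₀ (wk₀ a)))
  input = condᵗ (isSuccᵗ (wk₀ (wk₀ a))) (log₂ᵗ (wk₀ (wk₀ a))) (headᵗ (wk₀ (wk₀ s)) ∸ᵗ v₀)

  recurse : Term 6
  recurse = πᵗ self (πᵗ (πᵗ self (πᵗ v₀ (πᵗ (rightᵗ (var (# 2))) (nat 0)))) (nat 0))
    where
    self : Term 6
    self = wk₀ (wk₀ (wk₀ d))

  update : Term 7
  update = πᵗ (consᵗ (leftᵗ v₀) (leftᵗ (var (# 3)))) (rightᵗ v₀)

  final : Term 4
  final = πᵗ
    (condᵗ (isOneᵗ (wk₀ a)) (nat 0)
      (condᵗ (isSuccᵗ (wk₀ a)) (jumpTableᵗ (headᵗ (wk₀ s)) (headᵗ (leftᵗ v₀)))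
        (limTableᵗ (headᵗ (wk₀ s)) (leftᵗ v₀))))
    (rightᵗ v₀)

  bodyᶜ parseᶜ : Code
  bodyᶜ  = letᶜ (compᶜ universalᶜ (program (πᵗ index (πᵗ input (nat 0)))))
             (letᶜ (compᶜ universalᶜ (program recurse)) (program update))
  parseᶜ = letᶜ (compᶜ (loopᶜ (program init) bodyᶜ) (pairᶜ idᶜ (program count))) (program final)

  opaque
    self : ℕ
    self = ♯ parseᶜ

    φ-self : ∀ {n m} → Runs ∅ parseᶜ n m → φ self n m
    φ-self p = parseᶜ , sym (♯≡encode parseᶜ) , runs⇒eval p

  args : ℕ → ℕ → Vec ℕ 3
  args a s = self ∷ a ∷ s ∷ []

  Parses : ℕ → ℕ → ℕ → ℕ → Set
  Parses a s T r = Runs ∅ parseᶜ (env (args a s)) (π T r)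

  Loop : ℕ → ℕ → ℕ → ℕ → ℕ → Set
  Loop a s j acc r = Runs ∅ (loopᶜ (program init) bodyᶜ) (π (env (args a s)) j) (π acc r)

  runs-step : ∀ {a s j acc r b T r′} →
              φ (fn index (j ∷ π acc r ∷ args a s)) (fn input (j ∷ π acc r ∷ args a s)) b →
              Parses b r T r′ → Loop a s j acc r → Loop a s (suc j) (suc (π T acc)) r′
  runs-step {a} {s} {j} {acc} {r} {b} {T} {r′} φb p q = runs-loopₛ q
    (runs-let (compʳ (correct (πᵗ index (πᵗ input (nat 0))) ρ) (runs-universal φb))
      (runs-let (compʳ (correct recurse (b ∷ ρ)) (runs-universal (φ-self p′)))
        (subst (Runs ∅ (program update) _) update≡ (correct update (π T r′ ∷ b ∷ ρ)))))
    where
    ρ : Vec ℕ 5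
    ρ = j ∷ π acc r ∷ args a s

    p′ : Runs ∅ parseᶜ (env (self ∷ b ∷ right (π acc r) ∷ [])) (π T r′)
    p′ = subst (λ x → Runs ∅ parseᶜ (env (self ∷ b ∷ x ∷ [])) (π T r′)) (sym (right-π acc r)) p

    update≡ : fn update (π T r′ ∷ b ∷ ρ) ≡ π (suc (π T acc)) r′
    update≡ rewrite left-π T r′ | right-π T r′ | left-π acc r = refl

  runs-final : ∀ {a s acc r} → Loop a s (fn count (args a s)) acc r →
               Runs ∅ parseᶜ (env (args a s)) (fn final (π acc r ∷ args a s))
  runs-final {a} {s} {acc} {r} q = runs-let (compʳ (pairʳ runs-id (correct count (args a s))) q)
    (correct final (π acc r ∷ args a s))

  parse-one : ∀ {s} → Parses 1 s 0 s
  parse-one {s} = subst (Runs ∅ parseᶜ _) (cong (π 0) (right-π 0 s))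
    (runs-final (runs-loop₀ (correct init (args 1 s))))

  parse-succ : ∀ {a b s T r} → ∃[ k ] isOne a ≡ suc k → isSucc a ≡ 0 → log₂ a ≡ b →
               Parses b (tail s) T r → Parses a s (jumpTable (head s) T) r
  parse-succ {a} {b} {s} {T} {r} (k , eq₁) eq₂ eq₃ p =
    subst (Runs ∅ parseᶜ _) final≡ (runs-final (subst (λ j → Loop a s j (suc (π T 0)) r) (sym count≡)
      (runs-step φb p (runs-loop₀ (subst (Runs ∅ (program init) _) init≡ (correct init (args a s)))))))
    where
    count≡ : fn count (args a s) ≡ 1
    count≡ rewrite eq₁ | eq₂ = refl

    init≡ : fn init (args a s) ≡ π 0 (tail s)
    init≡ rewrite eq₁ = refl

    φb : φ (fn index (0 ∷ π 0 (tail s) ∷ args a s)) (fn input (0 ∷ π 0 (tail s) ∷ args a s)) b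
    φb rewrite eq₂ | eq₃ = idᶜ , sym (♯≡encode idᶜ) , runs⇒eval runs-id

    final≡ : fn final (π (suc (π T 0)) r ∷ args a s) ≡ π (jumpTable (head s) T) r
    final≡ rewrite eq₁ | eq₂ | left-π (suc (π T 0)) r | right-π (suc (π T 0)) r | left-π T 0 = refl

  module Lim {a z s : ℕ} (notOne : ∃[ k ] isOne a ≡ suc k) (notSucc : ∃[ k ] isSucc a ≡ suc k)
    (log : logₗ a ≡ z) where

    loop-init : Loop a s 0 0 (tail s)
    loop-init = runs-loop₀ (subst (Runs ∅ (program init) _) init≡ (correct init (args a s)))
      where
      init≡ : fn init (args a s) ≡ π 0 (tail s)
      init≡ rewrite proj₂ notOne = refl

    loop-step : ∀ {j b acc r T r′} → φ z (head s ∸ j) b → Parses b r T r′ →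
                Loop a s j acc r → Loop a s (suc j) (suc (π T acc)) r′
    loop-step {j} {b} {acc} {r} φb = runs-step φb′
      where
      φb′ : φ (fn index (j ∷ π acc r ∷ args a s)) (fn input (j ∷ π acc r ∷ args a s)) b
      φb′ rewrite proj₂ notSucc | log = φb

    loop-final : ∀ {acc r} → Loop a s (suc (head s)) acc r → Parses a s (limTable (head s) acc) r
    loop-final {acc} {r} p = subst (Runs ∅ parseᶜ _) final≡
      (runs-final (subst (λ j → Loop a s j acc r) (sym count≡) p))
      where
      count≡ : fn count (args a s) ≡ suc (head s)
      count≡ rewrite proj₂ notOne | proj₂ notSucc = refl

      final≡ : fn final (π acc r ∷ args a s) ≡ π (limTable (head s) acc) r
      final≡ rewrite proj₂ notOne | proj₂ notSucc | left-π acc r | right-π acc r = refl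

open Parse using (Parses; Loop; parse-one; parse-succ; module Lim; parseᶜ; self)
open Classification

tables : ∀ {F : ℕ → Family} → (∀ i {s} → F i s → ℕ) → ∀ m {t} → descending F m t → ℕ → ℕ
tables tab zero    t∈                       acc = suc (π (tab 0 t∈) acc)
tables tab (suc m) (_ , _ , s∈ , t∈ , _)    acc = tables tab m t∈ (suc (π (tab (suc m) s∈) acc))

table : ∀ {a} (p : 𝒪 a) {s} → B p s → ℕ
table one           _                                  = 0
table (succ p)      (_ , _ , (n , _) , t∈ , _)         = jumpTable n (table p t∈)
table (lim g _ p _) (n , _ , _ , _ , t∈ , _)           = limTable n (tables (λ i → table (p i)) n t∈ 0)

𝒪-positive : ∀ {a} → 𝒪 a → 0 < a
𝒪-positive one             = s≤s z≤n
𝒪-positive (succ {a} p)    = m^n>0 2 a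
𝒪-positive (lim {z} _ _ _ _) = ≤-trans (m^n>0 5 z) (m≤m+n _ _)

parse : ∀ {a} (p : 𝒪 a) {s} (s∈ : B p s) r → Parses a (code (s ++ r)) (table p s∈) (code r)
parse one refl r = parse-one
parse (succ {b} p) (_ , t , (n , refl) , t∈ , _ , refl) r =
  subst (λ h → Parses (2 ^ b) (code (n ∷ t ++ r)) (jumpTable h (table p t∈)) (code r)) (head-code n (t ++ r))
    (parse-succ (succ-notOne (𝒪-positive p)) (isSucc-succ b) (log₂-succ b)
      (subst (λ w → Parses b w (table p t∈) (code r)) (sym (tail-code n (t ++ r))) (parse p t∈ r)))
parse (lim {z} g φg p _) (n , _ , t , refl , t∈ , _ , refl) r =
  subst (λ h → Parses (3 * 5 ^ z) s (limTable h (tables tab n t∈ 0)) (code r)) head≡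
    (loop-final (subst (λ h → Loop (3 * 5 ^ z) s (suc h) (tables tab n t∈ 0) (code r)) (sym head≡)
      (go n 0 refl t∈ r 0 (subst (Loop (3 * 5 ^ z) s 0 0) (tail-code n (t ++ r)) loop-init))))
  where
  s = code (n ∷ t ++ r)

  head≡ : head s ≡ n
  head≡ = head-code n (t ++ r)

  tab : ∀ i {s} → B (p i) s → ℕ
  tab i = table (p i)

  open Lim {3 * 5 ^ z} {z} {s} (lim-notOne z) (lim-notSucc z) (logₗ-lim z)

  notation : ∀ j m → j + m ≡ n → φ z (head s ∸ j) (g m)
  notation j m eq = subst (λ i → φ z i (g m))
    (sym (trans (cong (_∸ j) (trans head≡ (sym eq))) (m+n∸m≡n j m))) (φg m)

  go : ∀ m j → j + m ≡ n → ∀ {t} (t∈ : descending (λ i → B (p i)) m t) r acc →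
       Loop (3 * 5 ^ z) s j acc (code (t ++ r)) → Loop (3 * 5 ^ z) s (suc n) (tables tab m t∈ acc) (code r)
  go zero j eq t∈ r acc q =
    subst (λ i → Loop (3 * 5 ^ z) s (suc i) (tables tab 0 t∈ acc) (code r)) (trans (sym (+-identityʳ j)) eq)
      (loop-step (notation j 0 eq) (parse (p 0) t∈ r) q)
  go (suc m) j eq (s′ , t′ , s∈ , t∈ , _ , refl) r acc q =
    go m (suc j) (trans (sym (+-suc j m)) eq) t∈ r _
      (loop-step (notation j (suc m) eq) (parse (p (suc m)) s∈ (t′ ++ r))
        (subst (λ l → Loop (3 * 5 ^ z) s j acc (code l)) (++-assoc s′ t′ r) q))

module _ {F : ℕ → Family} (tab : ∀ i {s} → F i s → ℕ) where

  drop-tables : ∀ m {t} (t∈ : descending F m t) acc → loop (tables tab m t∈ acc) (λ _ → tail) (suc m) ≡ acc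
  drop-tables zero    t∈                     acc = right-π _ acc
  drop-tables (suc m) (_ , _ , s∈ , t∈ , _) acc = trans (cong tail (drop-tables m t∈ _)) (right-π _ acc)

All<code : ∀ l → All (_< code l) l
All<code []      = []
All<code (x ∷ l) = head<code x l ∷ All.map (λ y< → <-trans y< (tail<code x l)) (All<code l)

decide-jump : ∀ A k → ¬ ¬ (∃[ N ] (∀ e → e < k →
  (∃[ w ] w ≤ N × (∀ {T} → Correct A T N → jumpRejects T e w ≡ 0)) ⊎ ¬ jump A e))
decide-jump A zero    fail = fail (0 , λ _ ())
decide-jump A (suc k) fail = decide-jump A k λ (N , decided) → ¬¬-excluded-middle λ where
    (yes k∈) → let w , j , p = jump⇒certificate k∈ in
      fail (N ⊔ (w ⊔ j) , λ e e<1+k → case (m≤n⇒m<n∨m≡n (s≤s⁻¹ e<1+k)) (decided e)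
        (m≤m⊔n N (w ⊔ j))
        (inj₁ (w , ≤-trans (m≤m⊔n w j) (m≤n⊔m N (w ⊔ j)) ,
          λ correct → p (correct-mono (≤-trans (m≤n⊔m w j) (m≤n⊔m N (w ⊔ j))) correct))))
    (no k∉) → fail (N , λ e e<1+k → case (m≤n⇒m<n∨m≡n (s≤s⁻¹ e<1+k)) (decided e) ≤-refl (inj₂ k∉))
  where
  Decided : ℕ → ℕ → Set
  Decided N e = (∃[ w ] w ≤ N × (∀ {T} → Correct A T N → jumpRejects T e w ≡ 0)) ⊎ ¬ jump A e

  case : ∀ {N N′ e} → e < k ⊎ e ≡ k → (e < k → Decided N e) → N ≤ N′ → Decided N′ k → Decided N′ e
  case (inj₁ e<k) decided N≤ _ with decided e<k
  ... | inj₁ (w , w≤ , p) = inj₁ (w , ≤-trans w≤ N≤ , λ correct → p (correct-mono N≤ correct))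
  ... | inj₂ e∉           = inj₂ e∉
  case (inj₂ refl) _ _ d = d

opaque
  unfolding π

  correct-lim : ∀ {A : ℕ → Pred ℕ 0ℓ} {T k} → Correct (λ q → A (right q) (left q)) T k →
                Correct (λ q → A (proj₂ (unpair q)) (proj₁ (unpair q))) T k
  correct-lim correct = correct

-- Approximation of H p from within an infinite set

module InfiniteSet {X : Pred ℕ 0ℓ} (infinite : Infinite X) where

  unbounded : ∀ b → ¬ ¬ (∃[ n ] b < n × X n)
  unbounded b fail = infinite (b , λ n Xn → ≮⇒≥ λ b<n → fail (n , b<n , Xn))

  approximable : ∀ {a} (p : 𝒪 a) b k → ¬ ¬ (∃[ s ] ∃ λ (s∈ : B p s) →
         s ⊑ X × All (b <_) s × Correct (H p) (table p s∈) k)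
  approximable one b k fail = fail ([] , refl , [] , [] , correct-nil k)
  approximable (succ p) b k fail =
    decide-jump (H p) k λ (N , decided) → unbounded (b ⊔ (k ⊔ N)) λ (n , n> , Xn) →
    approximable p n n λ (t , t∈ , t⊑X , t>n , correct) →
    let b<n = ≤-trans (s≤s (m≤m⊔n b (k ⊔ N))) n>
        k≤n = ≤-trans (≤-trans (m≤m⊔n k N) (m≤n⊔m b (k ⊔ N))) (<⇒≤ n>)
        N≤n = ≤-trans (≤-trans (m≤n⊔m k N) (m≤n⊔m b (k ⊔ N))) (<⇒≤ n>)
    in fail (n ∷ t , (_ , t , (n , refl) , t∈ , t>n ∷ [] , refl) , Xn ∷ t⊑X ,
           b<n ∷ All.map (<-trans b<n) t>n ,
           jumpTable-correct k≤n correct λ e e<k → certify N≤n correct (decided e e<k))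
    where
    certify : ∀ {N n T e} → N ≤ n → Correct (H p) T n →
              (∃[ w ] w ≤ N × (∀ {T} → Correct (H p) T N → jumpRejects T e w ≡ 0)) ⊎ ¬ jump (H p) e →
              (∃[ w ] w ≤ n × jumpRejects T e w ≡ 0) ⊎ ¬ jump (H p) e
    certify N≤n correct (inj₁ (w , w≤ , p)) = inj₁ (w , ≤-trans w≤ N≤n , p (correct-mono N≤n correct))
    certify N≤n correct (inj₂ e∉)           = inj₂ e∉
  approximable (lim g _ p _) b k fail =
    unbounded (b ⊔ k) λ (n , n> , Xn) → go n n λ (t , t∈ , t⊑X , t>n , correct) →
    let b<n = ≤-trans (s≤s (m≤m⊔n b k)) n>
        k≤n = ≤-trans (m≤n⊔m b k) (<⇒≤ n>)
    in fail (n ∷ t , (n , _ , t , refl , t∈ , t>n ∷ [] , refl) , Xn ∷ t⊑X ,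
           b<n ∷ All.map (<-trans b<n) t>n ,
           correct-lim {λ i → H (p i)} (limTable-correct {λ i → H (p i)} k≤n (correct 0)))
    where
    tab : ∀ i {s} → B (p i) s → ℕ
    tab i = table (p i)

    go : ∀ m b → ¬ ¬ (∃[ t ] ∃ λ (t∈ : descending (λ i → B (p i)) m t) → t ⊑ X × All (b <_) t ×
         (∀ acc i → i ≤ m → Correct (H (p i)) (nth i (tables tab m t∈ acc)) k))
    go zero b fail = approximable (p 0) b k λ (t , t∈ , t⊑X , t>b , correct) →
      fail (t , t∈ , t⊑X , t>b , λ { acc .0 z≤n →
        subst (λ T → Correct (H (p 0)) T k) (sym (left-π (table (p 0) t∈) acc)) correct })
    go (suc m) b fail = approximable (p (suc m)) b k λ (s , s∈ , s⊑X , s>b , correct) →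
      go m (b ⊔ code s) λ (t , t∈ , t⊑X , t> , corrects) →
      fail (s ++ t ,
          (s , t , s∈ , t∈ ,
            All.map (λ x< → All.map (λ y> → <-trans x< (≤-trans (s≤s (m≤n⊔m b (code s))) y>)) t>)
              (All<code s) , refl) ,
          ++⁺ s⊑X t⊑X , ++⁺ s>b (All.map (λ y> → ≤-trans (s≤s (m≤m⊔n b (code s))) y>) t>) ,
          λ acc i i≤ → case t∈ s∈ acc (m≤n⇒m<n∨m≡n i≤) (corrects _ i) correct)
      where
      case : ∀ {i s t} (t∈ : descending (λ i → B (p i)) m t) (s∈ : B (p (suc m)) s) acc →
             i < suc m ⊎ i ≡ suc m →
             (i ≤ m → Correct (H (p i)) (nth i (tables tab m t∈ (suc (π (table (p (suc m)) s∈) acc)))) k) →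
             Correct (H (p (suc m))) (table (p (suc m)) s∈) k →
             Correct (H (p i)) (nth i (tables tab m t∈ (suc (π (table (p (suc m)) s∈) acc)))) k
      case t∈ s∈ acc (inj₁ i<) correct _ = correct (s≤s⁻¹ i<)
      case t∈ s∈ acc (inj₂ refl) _ correct = subst (λ T → Correct (H (p (suc m))) T k)
        (sym (trans (cong head (drop-tables tab m t∈ _)) (left-π _ acc))) correct

-- The coloring

unused : ℕ → ℕ → ℕ
unused x w = 1 ∸ member x w

pairRejects : ℕ → ℕ → ℕ → ℕ → ℕ
pairRejects T e us w =
  suc x ∸ y + unused x us + unused y us + member (fact e x 1) F + member (fact e y 1) F + invalid T F
  where
  x = left w
  y = left (right w)
  F = right (right w)

pairRejectsᵗ : ∀ {k} → Term k → Term k → Term k → Term k → Term k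
pairRejectsᵗ a b c d = retype (call
  ((succᵗ x ∸ᵗ y) +ᵗ (nat 1 ∸ᵗ memberᵗ x us) +ᵗ (nat 1 ∸ᵗ memberᵗ y us) +ᵗ
   memberᵗ (factᵗ e x (nat 1)) F +ᵗ memberᵗ (factᵗ e y (nat 1)) F +ᵗ invalidᵗ T F)
  (a ∷ b ∷ c ∷ d ∷ [])) (λ ρ → pairRejects (fn a ρ) (fn b ρ) (fn c ρ) (fn d ρ)) (λ ρ → refl)
  where
  T e us w x y F : Term 4
  T  = v₀
  e  = v₁
  us = var (# 2)
  w  = var (# 3)
  x  = leftᵗ w
  y  = leftᵗ (rightᵗ w)
  F  = rightᵗ (rightᵗ w)

-- The state is π us ps with us the numbers already used and ps the pairs formed.
addPair : ℕ → ℕ → ℕ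
addPair st w = π (suc (π x (suc (π y (left st))))) (suc (π (π x y) (right st)))
  where
  x = left w
  y = left (right w)

addPairᵗ : ∀ {k} → Term k → Term k → Term k
addPairᵗ st w = πᵗ (consᵗ x (consᵗ y (leftᵗ st))) (consᵗ (πᵗ x y) (rightᵗ st))
  where
  x = leftᵗ w
  y = leftᵗ (rightᵗ w)

match : (T n i : ℕ) → ℕ
match T n = loop (π 0 0) λ e st →
  cond (pairRejects T e (left st) (search (pairRejects T e (left st)) n))
    (addPair st (search (pairRejects T e (left st)) n)) st

matchᵗ : ∀ {k} → Term k → Term k → Term k
matchᵗ a b = retype (call (loopᵗ v₁ (πᵗ (nat 0) (nat 0))
    (letᵗ (searchᵗ (var (# 3)) (pairRejectsᵗ (var (# 3)) v₁ (leftᵗ (var (# 2))) v₀))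
      (condᵗ (pairRejectsᵗ (var (# 3)) v₁ (leftᵗ (var (# 2))) v₀) (addPairᵗ (var (# 2)) v₀) (var (# 2)))))
  (a ∷ b ∷ [])) (λ ρ → match (fn a ρ) (fn b ρ) (fn b ρ)) (λ ρ → refl)

rep : ℕ → ℕ → ℕ
rep ps x = cond (member (π r x) ps) r x
  where
  r = search (λ r → member (π r x) ps) x

repᵗ : ∀ {k} → Term k → Term k → Term k
repᵗ a b = retype (call (letᵗ (searchᵗ v₁ (memberᵗ (πᵗ v₀ (var (# 2))) v₁))
    (condᵗ (memberᵗ (πᵗ v₀ (var (# 2))) v₁) v₀ (var (# 2)))) (a ∷ b ∷ []))
  (λ ρ → rep (fn a ρ) (fn b ρ)) (λ ρ → refl)

color : ℕ → ℕ → ℕ → ℕ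
color T x w = π (rep (right (match T (head w) (head w))) x) w

colorᵗ : ∀ {k} → Term k → Term k → Term k → Term k
colorᵗ T x w = πᵗ (repᵗ (rightᵗ (matchᵗ T (headᵗ w))) x) w

module _ (T n : ℕ) where

  record Matching (i : ℕ) (us ps : List ℕ) : Set where
    field
      state  : match T n i ≡ π (code us) (code ps)
      few    : length us ≤ i + i
      used   : ∀ {x y} → π x y ∈ ps → x < y × x ∈ us × y ∈ us
      first  : ∀ {x y y′} → π x y ∈ ps → π x y′ ∈ ps → y ≡ y′
      second : ∀ {x x′ y} → π x y ∈ ps → π x′ y ∈ ps → x ≡ x′
      apart  : ∀ {x y z} → π x y ∈ ps → ¬ π y z ∈ ps

  open Matching

  record Pairs (e : ℕ) (us : List ℕ) (w x y : ℕ) (l : List ℕ) : Set where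
    field
      w≡      : w ≡ π x (π y (code l))
      ordered : x < y
      x-new   : ¬ x ∈ us
      y-new   : ¬ y ∈ us
      x-fact  : fact e x 1 ∈ l
      y-fact  : fact e y 1 ∈ l
      isValid : Valid T l

  open Pairs

  unused⁻ : ∀ {x} us → unused x (code us) ≡ 0 → ¬ x ∈ us
  unused⁻ us p x∈ with () ← trans (sym (cong (1 ∸_) (member⁺ x∈))) p

  pairs⁺ : ∀ {e us w x y l} → Pairs e us w x y l → pairRejects T e (code us) w ≡ 0
  pairs⁺ {x = x} {y} {l} P
    rewrite w≡ P | left-π x (π y (code l)) | right-π x (π y (code l)) | left-π y (code l) | right-π y (code l)
          | m≤n⇒m∸n≡0 (ordered P) | member-∉ (x-new P) | member-∉ (y-new P)
          | member⁺ (x-fact P) | member⁺ (y-fact P) =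
    valid⁺ {l = l} (isValid P)

  pairs⁻ : ∀ e us w → pairRejects T e (code us) w ≡ 0 →
           ∃[ l ] Pairs e us w (left w) (left (right w)) l
  pairs⁻ e us w p with l , eq ← code-surjective (right (right w)) rewrite sym eq = l , record
    { w≡      = sym (trans (cong (π (left w))
                  (trans (cong (π (left (right w))) eq) (π-left-right (right w)))) (π-left-right w))
    ; ordered = m∸n≡0⇒m≤n (m+n≡0⇒m≡0 _ p₁)
    ; x-new = unused⁻ us (m+n≡0⇒n≡0 (suc (left w) ∸ left (right w)) p₁)
    ; y-new = unused⁻ us (m+n≡0⇒n≡0 (suc (left w) ∸ left (right w) + unused (left w) (code us)) p₂)
    ; x-fact  = member⁻ l (m+n≡0⇒n≡0 a p₃)
    ; y-fact  = member⁻ l (m+n≡0⇒n≡0 b p₄)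
    ; isValid = valid⁻ l (m+n≡0⇒n≡0 c p)
    }
    where
    a = suc (left w) ∸ left (right w) + unused (left w) (code us) + unused (left (right w)) (code us)
    b = a + member (fact e (left w) 1) (code l)
    c = b + member (fact e (left (right w)) 1) (code l)
    p₄ : c ≡ 0
    p₄ = m+n≡0⇒m≡0 c p
    p₃ : b ≡ 0
    p₃ = m+n≡0⇒m≡0 b p₄
    p₂ : a ≡ 0
    p₂ = m+n≡0⇒m≡0 a p₃
    p₁ : suc (left w) ∸ left (right w) + unused (left w) (code us) ≡ 0
    p₁ = m+n≡0⇒m≡0 (suc (left w) ∸ left (right w) + unused (left w) (code us)) p₂

  matching-zero : Matching 0 [] []
  matching-zero = record
    { state = refl ; few = z≤n ; used = λ () ; first = λ () ; second = λ () ; apart = λ () }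

  matching-add : ∀ {i us ps w x y l} → Pairs i us w x y l → Matching i us ps →
                 match T n (suc i) ≡ π (code (x ∷ y ∷ us)) (code (π x y ∷ ps)) →
                 Matching (suc i) (x ∷ y ∷ us) (π x y ∷ ps)
  matching-add {i} {us} {ps} {x = x} {y} P M eq = record
    { state  = eq
    ; few    = ≤-trans (s≤s (s≤s (few M))) (≤-reflexive (cong suc (sym (+-suc i i))))
    ; used   = used′
    ; first  = first′
    ; second = second′
    ; apart  = apart′
    }
    where
    used′ : ∀ {a b} → π a b ∈ π x y ∷ ps → a < b × a ∈ x ∷ y ∷ us × b ∈ x ∷ y ∷ us
    used′ (here eq) with refl , refl ← π-injective eq = ordered P , here refl , there (here refl)
    used′ (there q) = let a<b , a∈ , b∈ = used M q in a<b , there (there a∈) , there (there b∈)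

    first′ : ∀ {a b b′} → π a b ∈ π x y ∷ ps → π a b′ ∈ π x y ∷ ps → b ≡ b′
    first′ (here eq) (here eq′) = trans (proj₂ (π-injective eq)) (sym (proj₂ (π-injective eq′)))
    first′ (here eq) (there q) with refl , refl ← π-injective eq = ⊥-elim (x-new P (proj₁ (proj₂ (used M q))))
    first′ (there q) (here eq) with refl , refl ← π-injective eq = ⊥-elim (x-new P (proj₁ (proj₂ (used M q))))
    first′ (there q) (there q′) = first M q q′

    second′ : ∀ {a a′ b} → π a b ∈ π x y ∷ ps → π a′ b ∈ π x y ∷ ps → a ≡ a′
    second′ (here eq) (here eq′) = trans (proj₁ (π-injective eq)) (sym (proj₁ (π-injective eq′)))
    second′ (here eq) (there q) with refl , refl ← π-injective eq = ⊥-elim (y-new P (proj₂ (proj₂ (used M q))))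
    second′ (there q) (here eq) with refl , refl ← π-injective eq = ⊥-elim (y-new P (proj₂ (proj₂ (used M q))))
    second′ (there q) (there q′) = second M q q′

    apart′ : ∀ {a b z} → π a b ∈ π x y ∷ ps → ¬ π b z ∈ π x y ∷ ps
    apart′ (here eq) (here eq′) with refl , refl ← π-injective eq with refl , refl ← π-injective eq′ =
      <-irrefl refl (ordered P)
    apart′ (here eq) (there q) with refl , refl ← π-injective eq = y-new P (proj₁ (proj₂ (used M q)))
    apart′ (there q) (here eq) with refl , refl ← π-injective eq = x-new P (proj₂ (proj₂ (used M q)))
    apart′ (there q) (there q′) = apart M q q′

  Grows Stuck : (i : ℕ) (us ps : List ℕ) → Set
  Grows i us ps = ∃[ w ] ∃[ x ] ∃[ y ] ∃[ l ] Pairs i us w x y l ×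
    (∀ {w′ x′ y′ l′} → Pairs i us w′ x′ y′ l′ → w ≤ w′) × Matching (suc i) (x ∷ y ∷ us) (π x y ∷ ps)
  Stuck i us ps = (∀ {w x y l} → w ≤ n → ¬ Pairs i us w x y l) × Matching (suc i) us ps

  matching-step : ∀ {i us ps} → Matching i us ps → Grows i us ps ⊎ Stuck i us ps
  matching-step {i} {us} {ps} M = go (pairRejects T i (code us) w) refl
    where
    h : ℕ → ℕ
    h = pairRejects T i (code us)

    w : ℕ
    w = search h n

    next-state : ∀ {k} → h w ≡ k →
                 match T n (suc i) ≡ cond k (addPair (π (code us) (code ps)) w) (π (code us) (code ps))
    next-state refl rewrite state M | left-π (code us) (code ps) = refl

    add≡ : addPair (π (code us) (code ps)) w ≡
           π (code (left w ∷ left (right w) ∷ us)) (code (π (left w) (left (right w)) ∷ ps))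
    add≡ rewrite left-π (code us) (code ps) | right-π (code us) (code ps) = refl

    go : ∀ k → h w ≡ k → Grows i us ps ⊎ Stuck i us ps
    go zero eq with l , P ← pairs⁻ i us w eq =
      inj₁ (w , _ , _ , l , P , (λ {w′} Q → search≤witness h n {w′} (pairs⁺ Q)) ,
            matching-add P M (trans (next-state eq) add≡))
    go (suc k) eq = inj₂
      ((λ {w′} w≤n Q → 1+n≢0 (trans (sym eq) (search-finds h n {w′} (pairs⁺ Q) w≤n))) , record
        { state = next-state eq ; few = ≤-trans (few M) (+-mono-≤ (n≤1+n i) (n≤1+n i))
        ; used = used M ; first = first M ; second = second M ; apart = apart M })

  matching-extends : ∀ k {i us ps} → Matching i us ps → ∃[ us′ ] ∃[ ps′ ] Matching (k + i) us′ ps′ × ps ⊆ ps′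
  matching-extends zero    M = _ , _ , M , λ p∈ → p∈
  matching-extends (suc k) M with us , ps , M′ , ⊆ps ← matching-extends k M with matching-step M′
  ... | inj₁ (_ , _ , _ , _ , _ , _ , M″) = _ , _ , M″ , λ p∈ → there (⊆ps p∈)
  ... | inj₂ (_ , M″)                     = _ , _ , M″ , ⊆ps

  matching : ∀ i → ∃[ us ] ∃[ ps ] Matching i us ps
  matching i with us , ps , M , _ ← matching-extends i matching-zero =
    us , ps , subst (λ k → Matching k us ps) (+-identityʳ i) M

  module _ {i us ps} (M : Matching i us ps) where

    rep-second : ∀ {x y} → π x y ∈ ps → rep (code ps) y ≡ x
    rep-second {x} {y} p∈ 
      with r ← search-finds (λ r → member (π r y) (code ps)) y (member⁺ p∈) (<⇒≤ (proj₁ (used M p∈)))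
      rewrite r = sym (second M p∈ (member⁻ ps r))

    rep-cases : ∀ z → rep (code ps) z ≡ z ⊎ π (rep (code ps) z) z ∈ ps
    rep-cases z with member (π (search (λ r → member (π r z) (code ps)) z) z) (code ps) in eq
    ... | zero  = inj₂ (member⁻ ps eq)
    ... | suc _ = inj₁ refl

    rep-first : ∀ {x y} → π x y ∈ ps → rep (code ps) x ≡ x
    rep-first {x} p∈ with rep-cases x
    ... | inj₁ eq = eq
    ... | inj₂ q∈ = ⊥-elim (apart M q∈ p∈)

    rep-twoBounded : ∀ {x y z} → rep (code ps) x ≡ rep (code ps) y → rep (code ps) y ≡ rep (code ps) z →
                     x ≡ y ⊎ x ≡ z ⊎ y ≡ z
    rep-twoBounded {x} {y} {z} p q with rep-cases x | rep-cases y | rep-cases z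
    ... | inj₁ a | inj₁ b | _      = inj₁ (trans (sym a) (trans p b))
    ... | inj₁ a | inj₂ _ | inj₁ c = inj₂ (inj₁ (trans (sym a) (trans p (trans q c))))
    ... | inj₂ _ | inj₁ b | inj₁ c = inj₂ (inj₂ (trans (sym b) (trans q c)))
    ... | inj₂ a | inj₂ b | _      = inj₁ (first M (subst (λ r → π r x ∈ ps) p a) b)
    ... | inj₂ a | inj₁ _ | inj₂ c = inj₂ (inj₁ (first M (subst (λ r → π r x ∈ ps) (trans p q) a) c))
    ... | inj₁ _ | inj₂ b | inj₂ c = inj₂ (inj₂ (first M (subst (λ r → π r y ∈ ps) q b) c))

remove : ∀ u {l} → Increasing l →
         ∃[ l′ ] Increasing l′ × l′ ⊆ l × ¬ u ∈ l′ × length l ≤ suc (length l′)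
remove u [] = [] , [] , (λ x∈ → x∈) , (λ ()) , z≤n
remove u {x ∷ l} (x< ∷ inc) with u ≟ x
... | yes refl = l , inc , there , (λ u∈ → <-irrefl refl (All.lookup x< u∈)) , ≤-refl
... | no  u≢x with l′ , inc′ , ⊆l , u∉ , len ← remove u inc =
  x ∷ l′ , All.tabulate (λ y∈ → All.lookup x< (⊆l y∈)) ∷ inc′ ,
  (λ { (here eq) → here eq ; (there q) → there (⊆l q) }) ,
  (λ { (here eq) → u≢x eq ; (there q) → u∉ q }) , s≤s len

two-unused : ∀ us {l} → Increasing l → 2 + length us ≤ length l →
             ∃[ x ] ∃[ y ] x ∈ l × y ∈ l × x < y × ¬ x ∈ us × ¬ y ∈ us
two-unused [] {x ∷ y ∷ l} ((x<y ∷ _) ∷ _) _ = x , y , here refl , there (here refl) , x<y , (λ ()) , (λ ())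
two-unused [] {x ∷ []} _ (s≤s ())
two-unused (u ∷ us) inc len
  with l′ , inc′ , ⊆l , u∉ , len′ ← remove u inc
  with x , y , x∈ , y∈ , x<y , x∉ , y∉ ← two-unused us inc′ (s≤s⁻¹ (≤-trans len len′)) =
  x , y , ⊆l x∈ , ⊆l y∈ , x<y , (λ { (here refl) → u∉ x∈ ; (there q) → x∉ q }) ,
  (λ { (here refl) → u∉ y∈ ; (there q) → y∉ q })

∈⇒<code : ∀ {x l} → x ∈ l → x < code l
∈⇒<code {l = l} x∈ = All.lookup (All<code l) x∈

B-nonempty : ∀ {a} (p : 𝒪 a) → a ≢ 1 → ∀ {s} → B p s → ∃[ n ] ∃[ t ] s ≡ n ∷ t
B-nonempty one           a≢1 _                                    = ⊥-elim (a≢1 refl)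
B-nonempty (succ p)      _   (_ , t , (n , refl) , _ , _ , refl)  = n , t , refl
B-nonempty (lim _ _ _ _) _   (n , _ , t , refl , _ , _ , refl)    = n , t , refl

table-unique : ∀ {a} (p : 𝒪 a) {s} (s∈ s∈′ : B p s) → table p s∈ ≡ table p s∈′
table-unique p s∈ s∈′ = trans (sym (left-π (table p s∈) 0))
  (trans (cong left (runs-deterministic (parse p s∈ []) (parse p s∈′ []))) (left-π (table p s∈′) 0))

coloring : ∀ {a} (p : 𝒪 a) → ∃ (B₂ ⋆ B p) → ℕ
coloring p (_ , _ , s , (x , _) , s∈ , _) = color (table p s∈) x (code s)

coloring-computable : ∀ {a} (p : 𝒪 a) → Computable (coloring p)
coloring-computable {a} p = encode program′ , λ { (_ , _ , s , (x , refl) , s∈ , _ , refl) →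
  program′ , refl , runs⇒eval (subst₂ (Runs ∅ program′) (code≡⌜⌝ (x ∷ s)) (result s∈)
    (compʳ (pairʳ runs-id zeroʳ) (runs-let
      (compʳ (correct parseArgs (code (x ∷ s) ∷ [])) (parses s∈))
      (correct result-term (π (table p s∈) 0 ∷ code (x ∷ s) ∷ []))))) }
  where
  parseArgs : Term 1
  parseArgs = πᵗ (nat self) (πᵗ (nat a) (πᵗ (tailᵗ v₀) (nat 0)))

  result-term : Term 2
  result-term = colorᵗ (leftᵗ v₀) (headᵗ v₁) (tailᵗ v₁)

  program′ : Code
  program′ = compᶜ (letᶜ (compᶜ parseᶜ (program parseArgs)) (program result-term)) (pairᶜ idᶜ zeroᶜ)

  parses : ∀ {x s} (s∈ : B p s) → Parses a (tail (code (x ∷ s))) (table p s∈) 0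
  parses {x} {s} s∈ = subst (λ w → Parses a w (table p s∈) 0)
    (trans (cong code (++-identityʳ s)) (sym (tail-code x s))) (parse p s∈ [])

  result : ∀ {x s} (s∈ : B p s) →
           fn result-term (π (table p s∈) 0 ∷ code (x ∷ s) ∷ []) ≡ color (table p s∈) x (code s)
  result {x} {s} s∈ = cong₃ (left-π (table p s∈) 0) (head-code x s) (tail-code x s)
    where
    cong₃ : ∀ {T T′ x x′ w w′} → T ≡ T′ → x ≡ x′ → w ≡ w′ → color T x w ≡ color T′ x′ w′
    cong₃ refl refl refl = refl

coloring-twoBounded : ∀ {a} (p : 𝒪 a) → TwoBounded (coloring p)
coloring-twoBounded p (_ , _ , s , (x , refl) , s∈ , _ , refl) (_ , _ , t , (y , refl) , t∈ , _ , refl)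
                      (_ , _ , v , (z , refl) , v∈ , _ , refl) eq eq′
  with refl ← code-injective {s} {t} (proj₂ (π-injective eq))
     | refl ← code-injective {t} {v} (proj₂ (π-injective eq′))
  with us , ps , M ← matching (table p s∈) (head (code s)) (head (code s))
  rewrite table-unique p t∈ s∈ | table-unique p v∈ s∈ | Matching.state M | right-π (code us) (code ps)
  with rep-twoBounded _ _ M {x} {y} {z} (proj₁ (π-injective eq)) (proj₁ (π-injective eq′))
... | inj₁ refl        = inj₁ refl
... | inj₂ (inj₁ refl) = inj₂ (inj₁ refl)
... | inj₂ (inj₂ refl) = inj₂ (inj₂ refl)

completeness-Φ : ∀ {A e n m l} → Φ A e n m → Acceptable A l → Extends A l (fact e n m)
completeness-Φ {A} {l = l} (c , refl , ev) acc =
  subst (λ e → Extends A l (fact e _ _)) (♯≡encode c) (completeness (eval⇒runs c ev) acc)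

completeness-All : ∀ {A e xs} → All (λ x → Φ A e x 1) xs → ∃[ l ] Acceptable A l × All (λ x → fact e x 1 ∈ l) xs
completeness-All [] = [] , acceptable-nil , []
completeness-All (Φx ∷ Φxs)
  with l , acc , facts ← completeness-All Φxs
  with l′ , acc′ , ⊆l ← completeness-Φ Φx acc = _ , acc′ , here refl ∷ All.map ⊆l facts

coloring-noRainbow : ∀ {a} (p : 𝒪 a) → a ≢ 1 → ∀ {X} → Infinite X → X ≤ᵀ H p → ¬ Rainbow (coloring p) X
coloring-noRainbow {a} p a≢1 {X} infinite (e , reduction) rainbow = increasing (2 + (e + e)) 0 main
  where
  open InfiniteSet infinite

  increasing : ∀ k b → ¬ ¬ (∃[ xs ] length xs ≡ k × Increasing xs × xs ⊑ X × All (b <_) xs)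
  increasing zero    b fail = fail ([] , refl , [] , [] , [])
  increasing (suc k) b fail = unbounded b λ (n , b<n , Xn) → increasing k n λ (xs , len , inc , xs⊑X , n<) →
    fail (n ∷ xs , cong suc len , n< ∷ inc , Xn ∷ xs⊑X , b<n ∷ All.map (<-trans b<n) n<)

  main : ¬ (∃[ xs ] length xs ≡ 2 + (e + e) × Increasing xs × xs ⊑ X × All (0 <_) xs)
  main (xs , len , inc , xs⊑X , _)
    with l , (K , valid) , facts ← completeness-All
           (All.map (λ {x} Xx → reduction x 1 (inj₁ (Xx , refl))) xs⊑X) =
    approximable p N N contradiction
    where
    b = π (code xs) (π (code xs) (code l))
    N = b ⊔ (K ⊔ e)

    contradiction : ¬ (∃[ s ] ∃ λ (s∈ : B p s) →
                    s ⊑ X × All (N <_) s × Correct (H p) (table p s∈) N)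
    contradiction (s , s∈ , s⊑X , s> , correct)
      with n , t , refl ← B-nonempty p a≢1 s∈
      with us , ps , M ← matching (table p s∈) n e
      with x , y , x∈ , y∈ , x<y , x∉ , y∉ ← two-unused us inc
             (≤-trans (s≤s (s≤s (Matching.few M))) (≤-reflexive (sym len))) = conclude (matching-step T n M)
      where
      T = table p s∈

      N<n : N < n
      N<n = All.head s>

      w₀ = π x (π y (code l))

      w₀≤N : w₀ ≤ N
      w₀≤N = ≤-trans (π-mono-≤ (<⇒≤ (∈⇒<code x∈)) (π-mono-≤ (<⇒≤ (∈⇒<code y∈)) ≤-refl)) (m≤m⊔n b (K ⊔ e))

      P₀ : Pairs T n e us w₀ x y l
      P₀ = record
        { w≡ = refl ; ordered = x<y ; x-new = x∉ ; y-new = y∉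
        ; x-fact = All.lookup facts x∈ ; y-fact = All.lookup facts y∈
        ; isValid = valid (correct-mono (≤-trans (m≤m⊔n K e) (m≤n⊔m b (K ⊔ e))) correct) }

      open Pairs

      conclude : ¬ (Grows T n e us ps ⊎ Stuck T n e us ps)
      conclude (inj₂ (none , _)) = none (≤-trans w₀≤N (<⇒≤ N<n)) P₀
      conclude (inj₁ (w , x′ , y′ , l′ , P , least , M′)) =
        in-X (x-fact P) λ Xx′ → in-X (y-fact P) λ Xy′ →
        <-irrefl (∷-injectiveˡ (rainbow
          (elem x′ x′≤N) (elem y′ y′≤N) (Xx′ ∷ s⊑X) (Xy′ ∷ s⊑X) same-color)) (ordered P)
        where
        w≤N : w ≤ N
        w≤N = ≤-trans (least P₀) w₀≤N

        w′≤N : π x′ (π y′ (code l′)) ≤ N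
        w′≤N = subst (_≤ N) (w≡ P) w≤N

        x′≤N : x′ ≤ N
        x′≤N = ≤-trans (x≤π x′ _) w′≤N

        y′≤N : y′ ≤ N
        y′≤N = ≤-trans (≤-trans (x≤π y′ (code l′)) (y≤π x′ _)) w′≤N

        l′≤N : code l′ ≤ N
        l′≤N = ≤-trans (≤-trans (y≤π y′ (code l′)) (y≤π x′ _)) w′≤N

        in-X : ∀ {z} → fact e z 1 ∈ l′ → ¬ ¬ X z
        in-X {z} z∈ z∉X with c , refl , ev ← reduction z 0 (inj₂ (z∉X , refl))
          with () ← runs-deterministic (eval⇒runs c ev)
                      (runs (soundness l′ (correct-mono l′≤N correct) (isValid P) z∈) c (♯≡encode c))

        elem : ∀ z → z ≤ N → ∃ (B₂ ⋆ B p)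
        elem z z≤N = z ∷ n ∷ t , [ z ] , n ∷ t , (z , refl) , s∈ , All.map (≤-trans (s≤s z≤N)) s> ∷ [] , refl

        same-color : color T x′ (code (n ∷ t)) ≡ color T y′ (code (n ∷ t))
        same-color rewrite head-code n t with us″ , ps″ , M″ , ⊆ps ← matching-extends T n (n ∸ suc e) M′
          rewrite m∸n+n≡m {n} {suc e} (≤-trans (s≤s (≤-trans (m≤n⊔m K e) (m≤n⊔m b (K ⊔ e)))) N<n)
                | Matching.state M″ | right-π (code us″) (code ps″) =
          cong (λ r → π r (code (n ∷ t))) (trans (rep-first T n M″ (⊆ps (here refl)))
            (sym (rep-second T n M″ (⊆ps (here refl)))))

theorem18 : ∀ {a : ℕ} (p : 𝒪 a) → a ≢ 1 →
    ∃ λ (f : ∃ (B₂ ⋆ B p) → ℕ) → TwoBounded f × Computable f ×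
    ¬ (∃ λ (X : Pred ℕ 0ℓ) → Infinite X × (X ≤ᵀ H p) × Rainbow f X)
theorem18 p a≢1 = coloring p , coloring-twoBounded p , coloring-computable p ,
  λ (X , infinite , reducible , rainbow) → coloring-noRainbow p a≢1 infinite reducible rainbow
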